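{- Let $G$ be a finite or infinite connected graph with maximum valence 3. If $G$ has a vertex of valence 2 of type 2 but no vertex of valence 2 of type 1, then $G$ is isomorphic to $K_{2,3}$ or to $R^1_n$ for some $n$, or $D(G)\le 2$.
   Context: For a vertex $v$, the stabilizer $\mathrm{Aut}_v(G)$ induces a permutation group on the neighbors of $v$; the type of $v$ is its order (for valence 2: type 1 if trivial, type 2 if it swaps the two neighbors). $D(G)$ is the least number of colors in a vertex coloring of $G$ whose only color-preserving automorphism is the identity. For $n\ge1$, $T_n$ is the finite tree in which every vertex has valence 1 or 3 and every leaf has distance exactly $n$ from a fixed root. $R^1_n$ is obtained from $T_n$ by, for every pair of leaves $u,v$ with a common neighbor, adding two new vertices $x,y$ and edges $ux,xv,vy,yu$. -}

module Defs where

open import Data.Nat using (ℕ; zero; suc; _≤_)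
open import Data.Fin using (Fin; zero; suc)
open import Data.Bool using (Bool)
open import Data.Sum using (_⊎_; inj₁; inj₂)
open import Data.Product using (Σ; _×_; _,_; ∃)
open import Relation.Nullary using (¬_)
open import Relation.Binary.PropositionalEquality using (_≡_; _≢_)
open import Function.Bundles using (_↔_; Inverse; _⇔_)

record Graph : Set₁ where
  constructor graph
  field
    V : Set
    E : V → V → Set
open Graph public

IsSimple : Graph → Set
IsSimple G = (∀ a b → E G a b → E G b a) × (∀ a → ¬ E G a a)

data Walk (G : Graph) : V G → V G → Set where
  here : ∀ {a} → Walk G a a
  step : ∀ {a b c} → E G a b → Walk G b c → Walk G a c

Connected : Graph → Set
Connected G = ∀ a b → Walk G a b

Iso : Graph → Graph → Set
Iso G H = Σ (V G ↔ V H) λ f →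
  ∀ a b → E G a b ⇔ E H (Inverse.to f a) (Inverse.to f b)

Aut : Graph → Set
Aut G = Iso G G

aut : ∀ {G} → Aut G → V G → V G
aut (f , _) = Inverse.to f

HasValence : (G : Graph) → V G → ℕ → Set
HasValence G v k = Σ (Fin k → V G) λ ns →
  (∀ i j → ns i ≡ ns j → i ≡ j) × (∀ w → E G v w ⇔ (∃ λ i → ns i ≡ w))

MaxValence3 : Graph → Set
MaxValence3 G =
  (∀ v → Σ ℕ λ k → k ≤ 3 × HasValence G v k) × (∃ λ v → HasValence G v 3)

Type1 : (G : Graph) → V G → Set
Type1 G v = ∀ (φ : Aut G) → aut φ v ≡ v → ∀ w → E G v w → aut φ w ≡ w

-- for a vertex of valence 2: type 2 means some automorphism fixing v moves
-- (hence swaps) its neighbours, i.e. the induced group has order 2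
Type2 : (G : Graph) → V G → Set
Type2 G v = Σ (Aut G) λ φ → aut φ v ≡ v × (Σ (V G) λ w → E G v w × aut φ w ≢ w)

Distinguishing : (G : Graph) → (V G → Fin 2) → Set
Distinguishing G c = ∀ (φ : Aut G) → (∀ x → c (aut φ x) ≡ c x) → ∀ x → aut φ x ≡ x

D≤2 : Graph → Set
D≤2 G = Σ (V G → Fin 2) (Distinguishing G)

data K23E : Fin 2 ⊎ Fin 3 → Fin 2 ⊎ Fin 3 → Set where
  lr : ∀ i j → K23E (inj₁ i) (inj₂ j)
  rl : ∀ i j → K23E (inj₂ j) (inj₁ i)

K23 : Graph
K23 = graph (Fin 2 ⊎ Fin 3) K23E

data BV : ℕ → Set where
  top : ∀ {d} → BV d
  sub : ∀ {d} → Bool → BV d → BV (suc d)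

data BPar : {d : ℕ} → BV d → BV d → Set where
  top-sub : ∀ {d} (b : Bool) → BPar {suc d} top (sub b top)
  sub-sub : ∀ {d} (b : Bool) {x y : BV d} → BPar x y → BPar (sub b x) (sub b y)

data BLeaf : {d : ℕ} → BV d → Set where
  leaf0 : BLeaf {zero} top
  leafS : ∀ {d} (b : Bool) {x : BV d} → BLeaf x → BLeaf (sub b x)

-- T_{m+1}: a root joined to the tops of three binary trees of height m
data TV (m : ℕ) : Set where
  root : TV m
  br   : Fin 3 → BV m → TV m

data TPar {m : ℕ} : TV m → TV m → Set where
  root-br : ∀ i → TPar root (br i top)
  br-br   : ∀ i {x y : BV m} → BPar x y → TPar (br i x) (br i y)

TE : ∀ {m} → TV m → TV m → Set
TE a b = TPar a b ⊎ TPar b a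

data TLeaf {m : ℕ} : TV m → Set where
  leaf : ∀ i {x : BV m} → BLeaf x → TLeaf (br i x)

T[1+_] : ℕ → Graph
T[1+ m ] = graph (TV m) TE

-- New vertices of R^1: for every pair {u,v} of leaves with a common neighbour
-- two new vertices are added, each adjacent to both u and v.  We index them by
-- ORDERED pairs (u , v): the pair {u,v} yields (u,v) and (v,u), i.e. exactly
-- the two vertices x, y of the 4-cycle u x v y.  The side conditions are
-- irrelevant fields, so a new vertex is determined by (u , v).
record NewV (m : ℕ) : Set where
  constructor newv
  field
    u v : TV m
    .leafu : TLeaf u
    .leafv : TLeaf v
    .distinct : u ≢ v
    .common : Σ (TV m) λ w → TE w u × TE w v

data RV (m : ℕ) : Set where
  old : TV m → RV m
  new : NewV m → RV m

data RE {m : ℕ} : RV m → RV m → Set where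
  oo  : ∀ {a b} → TE a b → RE (old a) (old b)
  on₁ : ∀ (x : NewV m) → RE (old (NewV.u x)) (new x)
  on₂ : ∀ (x : NewV m) → RE (old (NewV.v x)) (new x)
  no₁ : ∀ (x : NewV m) → RE (new x) (old (NewV.u x))
  no₂ : ∀ (x : NewV m) → RE (new x) (old (NewV.v x))

R¹[1+_] : ℕ → Graph
R¹[1+ m ] = graph (RV m) RE

{-# OPTIONS --safe #-}
module Submission where

-- A valence-2 vertex x is flipped by an automorphism, so its ends have equal
-- valence, and this valence is 3 by connectedness: the graph arises from one
-- with valences 1 and 3 by subdividing edges.  Breadth-first search from a
-- fixed edge leaves at most two unfixed neighbours at each vertex, which get
-- different colours; it remains to make the starting edge recognisable.
--
-- Three valence-2 vertices with common ends give K_{2,3}.  A valence-2 vertex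
-- that shares its ends with no other one can be made the only black vertex of
-- its kind.  Otherwise the valence-2 vertices come in pairs forming diamonds
-- (4-cycles).  If two diamonds are adjacent, the graph is a necklace of
-- diamonds.  If the two other corners of a diamond have different outer
-- neighbours, the diamond itself serves as starting edge.  If all outer
-- neighbours coincide, cut the diamonds off: their outer neighbours become
-- leaves.  A leaf without a sibling leaf can be made recognisable; if all
-- leaves come in pairs, their parents are the leaves of the next round.  The
-- process stops at three mutual siblings, in which case the graph is R¹_n, or
-- never, in which case colouring siblings differently suffices.
--
-- All colourings are computable from finitely many classical case
-- distinctions, which the double negation in the conclusion permits.

open import Defs
open import Data.Nat using (ℕ; zero; suc; _≤_; _<_; z≤n; s≤s; _+_)
open import Data.Nat.Properties using (≤-antisym; ≤-trans; ≤-reflexive; <-irrefl; <-cmp; +-suc; +-identityʳ; +-cancelˡ-≡; ≤-refl; n<1+n; <⇒≱; n≤1+n; m≤m+n; <-trans; anyUpTo?)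
import Data.Nat.Properties as ℕₚ
open import Data.Bool using (Bool; true; false; if_then_else_; not) renaming (_≟_ to _≟ᵇ_)
open import Data.Fin using (Fin; zero; suc; toℕ)
open import Data.Fin.Properties using (injective⇒≤; toℕ-injective)
open import Data.Empty using (⊥; ⊥-elim)
open import Data.Sum using (_⊎_; inj₁; inj₂; [_,_]′)
open import Data.Product using (Σ; ∃; ∃₂; _×_; _,_; proj₁; proj₂)
open import Data.List using (List; []; _∷_; _++_; length; map; concatMap; lookup; tabulate)
open import Data.List.Properties using (length-map; length-tabulate; ∷-injective; ≡-dec)
import Data.List.Relation.Binary.Lex.Strict as Lex
open import Data.List.Relation.Binary.Pointwise using (Pointwise-≡⇒≡)
open import Data.Unit using (tt)
open import Data.List.Membership.Propositional using (_∈_; _∉_; find; lose)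
open import Data.List.Membership.Propositional.Properties using (∈-map⁺; ∈-map⁻; ∈-++⁺ˡ; ∈-++⁺ʳ; ∈-++⁻; ∈-concatMap⁺; ∈-concatMap⁻; ∈-lookup; ∈-tabulate⁺; ∈-tabulate⁻)
open import Data.List.Relation.Unary.Any using (here; there; index; any?)
open import Data.List.Relation.Unary.Any.Properties using (lookup-index)
open import Data.List.Relation.Unary.All as All using (All; []; _∷_; all?)
open import Data.List.Relation.Unary.AllPairs using ([]; _∷_)
open import Data.List.Relation.Unary.Unique.Propositional using (Unique)
import Data.List.Relation.Unary.Unique.Propositional.Properties as Unique
import Data.List.Membership.DecPropositional as DecMembership
open import Function using (_∘_; id; case_of_)
open import Function.Bundles using (Inverse; Equivalence; mk⇔; mk↔ₛ′)
open import Relation.Nullary using (¬_; Dec; yes; no; does; recompute)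
open import Relation.Nullary.Decidable using (_×-dec_; _⊎-dec_; ¬?; map′; decidable-stable; _→-dec_)
open import Relation.Binary.Definitions using (DecidableEquality; tri<; tri≈; tri>)
open import Relation.Binary.PropositionalEquality using (_≡_; _≢_; refl; sym; trans; cong; cong₂; subst; ≢-sym)

-- Every automorphism respects the kind of a vertex: of valence 2, corner of a diamond, or the rest
-- (the core). The two colours can therefore be spent afresh on each kind. Each search runs on a
-- smaller graph of valence at most 3 in which valence-2 vertices or whole diamonds are suppressed
-- to edges; the colours of the suppressed vertices then only have to resolve mates, multiple edges
-- and loops.
--
-- A search from a single vertex might begin with three unfixed neighbours, too many for two
-- colours; hence the start at an edge. The price is that this edge must be fixed together with its
-- direction. The case distinction is shaped by this: each case either supplies an edge that two
-- colours can mark and orient, or gets by without a search.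
--
-- The assumption on types acts through flips in two places: the equal valence of the two ends of a
-- valence-2 vertex, and the passage across a diamond in a necklace. A flip is known to exist only
-- up to double negation, so the goals it serves are kept decidable.

∃∈? : ∀ {A : Set} {P : A → Set} → (∀ x → Dec (P x)) → ∀ xs → Dec (∃ λ x → x ∈ xs × P x)
∃∈? P? xs = map′ find (λ (_ , m , p) → lose m p) (any? P? xs)

∀∈? : ∀ {A : Set} {P : A → Set} → (∀ x → Dec (P x)) → ∀ xs → Dec (∀ x → x ∈ xs → P x)
∀∈? P? xs = map′ (λ all _ → All.lookup all) (λ f → All.tabulate (f _)) (all? P? xs)

-- Counting in duplicate-free lists

unique-lookup-injective : ∀ {A : Set} {xs : List A} → Unique xs →
  ∀ {i j} → lookup xs i ≡ lookup xs j → i ≡ j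
unique-lookup-injective (_ ∷ _)  {zero}  {zero}  _  = refl
unique-lookup-injective (a ∷ _)  {zero}  {suc j} eq = ⊥-elim (All.lookup a (∈-lookup j) eq)
unique-lookup-injective (a ∷ _)  {suc i} {zero}  eq = ⊥-elim (All.lookup a (∈-lookup i) (sym eq))
unique-lookup-injective (_ ∷ us) {suc i} {suc j} eq = cong suc (unique-lookup-injective us eq)

unique-⊆-length : ∀ {A : Set} {xs ys : List A} → Unique xs →
  (∀ {x} → x ∈ xs → x ∈ ys) → length xs ≤ length ys
unique-⊆-length {xs = xs} {ys} u incl = injective⇒≤ {f = pos} λ {i} {j} eq →
  unique-lookup-injective u
    (trans (at i) (trans (cong (lookup ys) eq) (sym (at j))))
  where
  pos : Fin (length xs) → Fin (length ys)
  pos i = index (incl (∈-lookup i))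
  at : ∀ i → lookup xs i ≡ lookup ys (pos i)
  at i = lookup-index (incl (∈-lookup i))

no-four : ∀ {A : Set} {xs : List A} {a b c d : A} → length xs ≤ 3 →
  a ∈ xs → b ∈ xs → c ∈ xs → d ∈ xs →
  a ≢ b → a ≢ c → a ≢ d → b ≢ c → b ≢ d → c ≢ d → ⊥
no-four {xs = xs} {a} {b} {c} {d} le a∈ b∈ c∈ d∈ ab ac ad bc bd cd =
  <-irrefl refl (≤-trans
    (unique-⊆-length {xs = a ∷ b ∷ c ∷ d ∷ []}
      ((ab ∷ ac ∷ ad ∷ []) ∷ (bc ∷ bd ∷ []) ∷ (cd ∷ []) ∷ [] ∷ []) incl) le)
  where
  incl : ∀ {x} → x ∈ a ∷ b ∷ c ∷ d ∷ [] → x ∈ xs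
  incl (here refl) = a∈
  incl (there (here refl)) = b∈
  incl (there (there (here refl))) = c∈
  incl (there (there (there (here refl)))) = d∈

-- Graphs given by neighbour lists, their automorphisms and 2-colourings

record Tiebreak (A : Set) : Set₁ where
  field
    _≺_     : A → A → Set
    _≺?_    : ∀ x y → Dec (x ≺ y)
    ≺-asym  : ∀ {x y} → x ≺ y → ¬ y ≺ x
    ≺-total : ∀ {x y} → x ≢ y → x ≺ y ⊎ y ≺ x

-- Connectedness takes the form of the induction principle `spread`. The order `tiebreak` only ever
-- selects one of two vertices, so asymmetry and totality are all that is asked of it.
record CubicGraph : Set₁ where
  field
    Vertex    : Set
    _≟_       : DecidableEquality Vertex
    nb        : Vertex → List Vertex
    nb-unique : ∀ x → Unique (nb x)
    nb-sym    : ∀ {x y} → y ∈ nb x → x ∈ nb y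
    nb-irrefl : ∀ {x} → x ∉ nb x
    nb-≤3     : ∀ x → length (nb x) ≤ 3
    tiebreak  : Tiebreak Vertex
    spread    : ∀ (P : Vertex → Set) → (∀ {x y} → y ∈ nb x → P x → P y) →
                ∀ {x} → P x → ∀ y → P y
  open DecMembership _≟_ public using (_∈?_)
  open Tiebreak tiebreak public

  two-neighbours : ∀ {x y z w} → length (nb x) ≡ 2 → y ∈ nb x → z ∈ nb x → y ≢ z →
    w ∈ nb x → w ≡ y ⊎ w ≡ z
  two-neighbours {x} len = go (nb x) len
    where
    go : ∀ xs → length xs ≡ 2 → ∀ {y z w} → y ∈ xs → z ∈ xs → y ≢ z → w ∈ xs → w ≡ y ⊎ w ≡ z
    go (_ ∷ _ ∷ []) _ (here refl)         (here refl)         y≢z _                   = ⊥-elim (y≢z refl)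
    go (_ ∷ _ ∷ []) _ (there (here refl)) (there (here refl)) y≢z _                   = ⊥-elim (y≢z refl)
    go (_ ∷ _ ∷ []) _ (here refl)         (there (here refl)) _   (here refl)         = inj₁ refl
    go (_ ∷ _ ∷ []) _ (here refl)         (there (here refl)) _   (there (here refl)) = inj₂ refl
    go (_ ∷ _ ∷ []) _ (there (here refl)) (here refl)         _   (here refl)         = inj₂ refl
    go (_ ∷ _ ∷ []) _ (there (here refl)) (here refl)         _   (there (here refl)) = inj₁ refl

  another-neighbour : ∀ {x} → 2 ≤ length (nb x) → ∀ y → ∃ λ z → z ∈ nb x × z ≢ y
  another-neighbour {x} le y with nb x | nb-unique x
  another-neighbour {x} (s≤s ()) y | _ ∷ [] | _
  another-neighbour {x} le y | a ∷ b ∷ _ | (a≢b ∷ _) ∷ _ with a ≟ y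
  ... | yes refl = b , there (here refl) , ≢-sym a≢b
  ... | no a≢y = a , here refl , a≢y

  third-neighbour : ∀ {x} → length (nb x) ≡ 3 → ∀ y z → ∃ λ w → w ∈ nb x × w ≢ y × w ≢ z
  third-neighbour {x} len y z with nb x | nb-unique x
  ... | a ∷ b ∷ c ∷ [] | (a≢b ∷ a≢c ∷ []) ∷ (b≢c ∷ []) ∷ _
      with a ≟ y | a ≟ z | b ≟ y | b ≟ z
  ... | no a≢y | no a≢z | _ | _ = a , here refl , a≢y , a≢z
  ... | yes refl | _ | no b≢y | no b≢z = b , there (here refl) , b≢y , b≢z
  ... | no _ | yes refl | no b≢y | no b≢z = b , there (here refl) , b≢y , b≢z
  ... | yes refl | _ | yes b≡y | _ = ⊥-elim (a≢b (sym b≡y))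
  ... | yes refl | _ | no _ | yes refl = c , there (there (here refl)) , ≢-sym a≢c , ≢-sym b≢c
  ... | no _ | yes refl | _ | yes b≡z = ⊥-elim (a≢b (sym b≡z))
  ... | no _ | yes refl | yes refl | no _ = c , there (there (here refl)) , ≢-sym b≢c , ≢-sym a≢c

  three-neighbours : ∀ {x y z w v} → y ∈ nb x → z ∈ nb x → w ∈ nb x → y ≢ z → y ≢ w → z ≢ w →
    v ∈ nb x → v ≡ y ⊎ v ≡ z ⊎ v ≡ w
  three-neighbours {x} {y} {z} {w} {v} y∈ z∈ w∈ y≢z y≢w z≢w v∈ with v ≟ y | v ≟ z | v ≟ w
  ... | yes e | _ | _ = inj₁ e
  ... | no _ | yes e | _ = inj₂ (inj₁ e)
  ... | no _ | no _ | yes e = inj₂ (inj₂ e)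
  ... | no p | no q | no r = ⊥-elim (no-four (nb-≤3 x) v∈ y∈ z∈ w∈ p q r y≢z y≢w z≢w)

record Automorphism (𝒢 : CubicGraph) : Set where
  open CubicGraph 𝒢
  field
    to      : Vertex → Vertex
    from    : Vertex → Vertex
    to-from : ∀ x → to (from x) ≡ x
    from-to : ∀ x → from (to x) ≡ x
    to-nb   : ∀ {x y} → y ∈ nb x → to y ∈ nb (to x)
    from-nb : ∀ {x y} → y ∈ nb x → from y ∈ nb (from x)

  to-injective : ∀ {x y} → to x ≡ to y → x ≡ y
  to-injective {x} {y} eq = trans (sym (from-to x)) (trans (cong from eq) (from-to y))

  from-injective : ∀ {x y} → from x ≡ from y → x ≡ y
  from-injective {x} {y} eq = trans (sym (to-from x)) (trans (cong to eq) (to-from y))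

  to-nb⁻ : ∀ {x y} → to y ∈ nb (to x) → y ∈ nb x
  to-nb⁻ {x} {y} m with from-nb m
  ... | m′ rewrite from-to x | from-to y = m′

  to-valence : ∀ x → length (nb (to x)) ≡ length (nb x)
  to-valence x = ≤-antisym
    (≤-trans (≤-reflexive (sym (length-map from (nb (to x)))))
      (unique-⊆-length (Unique.map⁺ from-injective (nb-unique (to x))) back))
    (≤-trans (≤-reflexive (sym (length-map to (nb x))))
      (unique-⊆-length (Unique.map⁺ to-injective (nb-unique x)) forth))
    where
    forth : ∀ {z} → z ∈ map to (nb x) → z ∈ nb (to x)
    forth m with ∈-map⁻ to m
    ... | _ , y∈ , refl = to-nb y∈
    back : ∀ {z} → z ∈ map from (nb (to x)) → z ∈ nb x
    back m with ∈-map⁻ from m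
    ... | y , y∈ , refl = subst (λ w → from y ∈ nb w) (from-to x) (from-nb y∈)

inverse : ∀ {𝒢} → Automorphism 𝒢 → Automorphism 𝒢
inverse φ = record
  { to = from ; from = to ; to-from = from-to ; from-to = to-from ; to-nb = from-nb ; from-nb = to-nb }
  where open Automorphism φ

record TwoColouring (𝒢 : CubicGraph) : Set₁ where
  open CubicGraph 𝒢
  field
    Black  : Vertex → Set
    Black? : ∀ x → Dec (Black x)

Preserves : ∀ {𝒢} → TwoColouring 𝒢 → Automorphism 𝒢 → Set
Preserves c φ = ∀ x → (Black x → Black (to x)) × (Black (to x) → Black x)
  where open TwoColouring c
        open Automorphism φ

Rigid : ∀ {𝒢} → TwoColouring 𝒢 → Set
Rigid {𝒢} c = ∀ φ → Preserves c φ → ∀ x → Automorphism.to φ x ≡ x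

TwoDistinguishable : CubicGraph → Set₁
TwoDistinguishable 𝒢 = Σ (TwoColouring 𝒢) Rigid

-- Breadth-first colouring from an edge

module _ (𝒢 : CubicGraph) where
  open CubicGraph 𝒢

  -- Breadth-first search from both ends of an edge p u.  Every vertex has a
  -- neighbour in its own ball or one below, hence at most two neighbours above,
  -- and so a vertex can be confused with at most one other vertex (its twin).
  module Levels (Core : Vertex → Set) (hn : Vertex → List Vertex)
    (hn-core : ∀ {x y} → Core x → y ∈ hn x → Core y)
    (hn-sym : ∀ {x y} → Core x → y ∈ hn x → x ∈ hn y)
    (hn-≤3 : ∀ x → length (hn x) ≤ 3)
    (p u : Vertex) (p-core : Core p) (u∈p : u ∈ hn p)
    (core-spread : ∀ (P : Vertex → Set) → (∀ {x y} → Core x → y ∈ hn x → P x → P y) →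
                   P p → ∀ x → Core x → P x)
    (choice : Tiebreak Vertex)
    where

    open Tiebreak choice renaming (_≺_ to _⊲_; _≺?_ to _⊲?_; ≺-asym to ⊲-asym; ≺-total to ⊲-total)

    ball : ℕ → List Vertex
    ball zero    = p ∷ u ∷ []
    ball (suc n) = ball n ++ concatMap hn (ball n)

    ball-suc : ∀ n {x s} → s ∈ ball n → x ∈ hn s → x ∈ ball (suc n)
    ball-suc n s∈ x∈ = ∈-++⁺ʳ (ball n) (∈-concatMap⁺ hn (lose s∈ x∈))

    ball-suc⁻ : ∀ n {x} → x ∈ ball (suc n) → x ∈ ball n ⊎ ∃ λ s → s ∈ ball n × x ∈ hn s
    ball-suc⁻ n m with ∈-++⁻ (ball n) m
    ... | inj₁ m′ = inj₁ m′
    ... | inj₂ m′ = inj₂ (find (∈-concatMap⁻ hn m′))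

    ball-mono : ∀ {n} m x → n ≤ m → x ∈ ball n → x ∈ ball m
    ball-mono {zero}  zero  x le m = m
    ball-mono {zero}  (suc k) x le m = ∈-++⁺ˡ (ball-mono k x z≤n m)
    ball-mono {suc n} (suc k) x (s≤s le) m with ball-suc⁻ n m
    ... | inj₁ m′ = ∈-++⁺ˡ (ball-mono k x le m′)
    ... | inj₂ (s , s∈ , x∈) = ball-suc k (ball-mono k s le s∈) x∈

    root∈ball : ∀ n → p ∈ ball n
    root∈ball n = ball-mono n p z≤n (here refl)

    ball-core : ∀ n {x} → x ∈ ball n → Core x
    ball-core zero (here refl) = p-core
    ball-core zero (there (here refl)) = hn-core p-core u∈p
    ball-core (suc n) m with ball-suc⁻ n m
    ... | inj₁ m′ = ball-core n m′
    ... | inj₂ (s , s∈ , x∈) = hn-core (ball-core n s∈) x∈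

    reach : ∀ x → Core x → ∃ λ n → x ∈ ball n
    reach = core-spread (λ x → ∃ λ n → x ∈ ball n)
      (λ _ y∈ (n , m) → suc n , ball-suc n m y∈) (0 , here refl)

    Level : ℕ → Vertex → Set
    Level n x = x ∈ ball (suc n) × x ∉ ball n

    outside⇒< : ∀ {n m x} → x ∈ ball n → x ∉ ball m → m < n
    outside⇒< {n} {m} {x} i o with ℕₚ.<-≤-connex m n
    ... | inj₁ m<n = m<n
    ... | inj₂ n≤m = ⊥-elim (o (ball-mono m x n≤m i))

    level-unique : ∀ n m {x} → Level n x → Level m x → n ≡ m
    level-unique _ _ (i , o) (i′ , o′) =
      ≤-antisym (ℕₚ.≤-pred (outside⇒< i′ o)) (ℕₚ.≤-pred (outside⇒< i o′))

    below : ∀ n {x} → Level n x → ∃ λ s → s ∈ ball n × s ∈ hn x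
    below n (i , o) with ball-suc⁻ n i
    ... | inj₁ m = ⊥-elim (o m)
    ... | inj₂ (s , s∈ , x∈) = s , s∈ , hn-sym (ball-core n s∈) x∈

    -- Here the start at an edge pays off: the two ends are companions of each other, and every
    -- later vertex has the one from which it was reached.
    companion : ∀ n {s} → s ∈ ball n → ∃ λ r → r ∈ ball n × r ∈ hn s
    companion zero (here refl) = u , there (here refl) , u∈p
    companion zero (there (here refl)) = p , here refl , hn-sym p-core u∈p
    companion (suc n) m with ball-suc⁻ n m
    ... | inj₁ m′ = let r , r∈ , e = companion n m′ in r , ∈-++⁺ˡ r∈ , e
    ... | inj₂ (s , s∈ , x∈) = s , ∈-++⁺ˡ s∈ , hn-sym (ball-core n s∈) x∈

    -- The pairs that an automorphism fixing `ball n` pointwise might confuse: nothing inside the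
    -- ball tells them apart.
    record Twin (n : ℕ) (x y : Vertex) : Set where
      constructor twin
      field
        distinct : x ≢ y
        levelˡ   : Level n x
        levelʳ   : Level n y
        lowerˡ   : ∀ {s} → s ∈ hn x → s ∈ ball n → s ∈ hn y
        lowerʳ   : ∀ {s} → s ∈ hn y → s ∈ ball n → s ∈ hn x

    twin-sym : ∀ {n x y} → Twin n x y → Twin n y x
    twin-sym (twin d l l′ s s′) = twin (≢-sym d) l′ l s′ s

    -- A lower neighbour `s` of `x` is also adjacent to every twin of `x` and to its own companion
    -- in the ball; two twins of `x` would give `s` four neighbours.
    twin-unique : ∀ {n x y z} → Twin n x y → Twin n x z → y ≡ z
    twin-unique {n} {x} {y} {z} t t′ with y ≟ z
    ... | yes e = e
    ... | no y≢z =
      let s , s∈ , sx = below n (Twin.levelˡ t)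
          r , r∈ , rs = companion n s∈
          above : ∀ {w} → Level n w → s ∈ hn w → w ∈ hn s
          above (i , _) e = hn-sym (ball-core (suc n) i) e
          apart : ∀ {w} → Level n w → w ≢ r
          apart (_ , o) w≡r = o (subst (_∈ ball n) (sym w≡r) r∈)
          open Twin
      in ⊥-elim (no-four (hn-≤3 s)
           (above (levelˡ t) sx) (above (levelʳ t) (lowerˡ t sx s∈)) (above (levelʳ t′) (lowerˡ t′ sx s∈)) rs
           (distinct t) (distinct t′) (apart (levelˡ t)) y≢z (apart (levelʳ t)) (apart (levelʳ t′)))

    Twin? : ∀ n x y → Dec (Twin n x y)
    Twin? n x y = map′ (λ (d , l , l′ , f , g) → twin d l l′ (λ {s} → f s) (λ {s} → g s))
      (λ (twin d l l′ f g) → d , l , l′ , (λ _ → f) , λ _ → g)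
      (¬? (x ≟ y) ×-dec Level? x ×-dec Level? y
        ×-dec ∀∈? (λ s → (s ∈? ball n) →-dec (s ∈? hn y)) (hn x)
        ×-dec ∀∈? (λ s → (s ∈? ball n) →-dec (s ∈? hn x)) (hn y))
      where
      Level? : ∀ x → Dec (Level n x)
      Level? x = (x ∈? ball (suc n)) ×-dec ¬? (x ∈? ball n)

    CoreBlack : Vertex → Set
    CoreBlack x = x ≡ p ⊎ ∃₂ λ n y → Twin n x y × x ⊲ y

    -- A twin at level `n` keeps `x` out of `ball n`, so `n` is bounded by the radius at which
    -- `reach` finds `x`, and the search is finite.
    CoreBlack? : ∀ x → Core x → Dec (CoreBlack x)
    CoreBlack? x cx = (x ≟ p) ⊎-dec map′
      (λ (n , _ , y , _ , t , c) → n , y , t , c)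
      (λ (n , y , t , c) → n , outside⇒< (proj₂ (reach x cx)) (proj₂ (Twin.levelˡ t))
                             , y , proj₁ (Twin.levelʳ t) , t , c)
      (anyUpTo? (λ n → ∃∈? (λ y → Twin? n x y ×-dec (x ⊲? y)) (ball (suc n))) (proj₁ (reach x cx)))

    twin-black : ∀ {n x y} → Twin n x y → CoreBlack x → x ⊲ y
    twin-black {n} t (inj₁ refl) = ⊥-elim (proj₂ (Twin.levelˡ t) (root∈ball n))
    twin-black {n} t (inj₂ (m , z , t′ , c)) with level-unique n m (Twin.levelˡ t) (Twin.levelˡ t′)
    ... | refl with twin-unique t t′
    ... | refl = c

    -- Both ends lie in every ball and have no twins, so `p` is black and `u` white, which orients
    -- the starting edge.
    second-root-white : p ≢ u → ¬ CoreBlack u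
    second-root-white p≢u (inj₁ e) = p≢u (sym e)
    second-root-white p≢u (inj₂ (n , _ , t , _)) =
      proj₂ (Twin.levelˡ t) (ball-mono n u z≤n (there (here refl)))

    module _ (φ : Automorphism 𝒢) where
      open Automorphism φ

      module _
        (to-hn : ∀ {x y} → Core x → y ∈ hn x → to y ∈ hn (to x))
        (to-hn⁻ : ∀ {x y} → Core x → to y ∈ hn (to x) → y ∈ hn x)
        (keep : ∀ x → Core x → (CoreBlack x → CoreBlack (to x)) × (CoreBlack (to x) → CoreBlack x))
        (fix-p : to p ≡ p) (fix-u : to u ≡ u)
        where

        -- If a vertex of the next layer is moved while `ball n` is fixed, its image is a twin of
        -- it; but exactly one of two twins is black.
        ball-fixed : ∀ n {x} → x ∈ ball n → to x ≡ x
        ball-fixed zero (here refl) = fix-p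
        ball-fixed zero (there (here refl)) = fix-u
        ball-fixed (suc n) {x} m with to x ≟ x | ball-suc⁻ n m
        ... | yes e | _ = e
        ... | no _ | inj₁ m′ = ball-fixed n m′
        ... | no x≢ | inj₂ (s , s∈ , x∈) = ⊥-elim confused
          where
          cs = ball-core n s∈
          cx = ball-core (suc n) m
          moved : to x ∉ ball n
          moved i = x≢ (to-injective (ball-fixed n i))
          x∉ : x ∉ ball n
          x∉ i = x≢ (ball-fixed n i)
          tx∈s : to x ∈ hn s
          tx∈s = subst (λ w → to x ∈ hn w) (ball-fixed n s∈) (to-hn cs x∈)
          t : Twin n x (to x)
          t = twin (≢-sym x≢) (m , x∉) (ball-suc n s∈ tx∈s , moved)
            (λ r∈ rb → subst (_∈ hn (to x)) (ball-fixed n rb) (to-hn cx r∈))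
            (λ r∈ rb → to-hn⁻ cx (subst (_∈ hn (to x)) (sym (ball-fixed n rb)) r∈))
          confused : ⊥
          confused with ⊲-total (Twin.distinct t)
          ... | inj₁ c = ⊲-asym c (twin-black (twin-sym t) (proj₁ (keep x cx) (inj₂ (n , _ , t , c))))
          ... | inj₂ c = ⊲-asym c (twin-black t (proj₂ (keep x cx) (inj₂ (n , _ , twin-sym t , c))))

        core-fixed : ∀ x → Core x → to x ≡ x
        core-fixed x cx = let n , m = reach x cx in ball-fixed n m

-- The failure of type 1 yields a flip only under a double negation. Handing the flip to a
-- continuation with a decidable goal `Q` is what this allows.
Flippable : CubicGraph → Set₁
Flippable 𝒢 = ∀ {x a b} → length (nb x) ≡ 2 → a ∈ nb x → b ∈ nb x → a ≢ b →
  ∀ {Q : Set} → Dec Q → (∀ (φ : Automorphism 𝒢) → let open Automorphism φ in to x ≡ x → to a ≡ b → to b ≡ a → Q) → Q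
  where open CubicGraph 𝒢 using (nb)

data At {A : Set} : ℕ → List A → A → Set where
  at-zero : ∀ {x xs} → At zero (x ∷ xs) x
  at-suc  : ∀ {i x y xs} → At i xs x → At (suc i) (y ∷ xs) x

at-functional : ∀ {A : Set} {i} {xs : List A} {x y} → At i xs x → At i xs y → x ≡ y
at-functional at-zero    at-zero    = refl
at-functional (at-suc p) (at-suc q) = at-functional p q

at-∈ : ∀ {A : Set} {i} {xs : List A} {x} → At i xs x → x ∈ xs
at-∈ at-zero    = here refl
at-∈ (at-suc p) = there (at-∈ p)

at-injective : ∀ {A : Set} {i j} {xs : List A} {x} → Unique xs → At i xs x → At j xs x → i ≡ j
at-injective _        at-zero    at-zero    = refl
at-injective (a ∷ _)  at-zero    (at-suc q) = ⊥-elim (All.lookup a (at-∈ q) refl)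
at-injective (a ∷ _)  (at-suc p) at-zero    = ⊥-elim (All.lookup a (at-∈ p) refl)
at-injective (_ ∷ us) (at-suc p) (at-suc q) = cong suc (at-injective us p q)

position : ∀ {A : Set} {xs : List A} {x} → x ∈ xs → ∃ λ i → i < length xs × At i xs x
position (here refl) = zero , s≤s z≤n , at-zero
position (there m)   = let i , i< , p = position m in suc i , s≤s i< , at-suc p

at? : ∀ {A : Set} → DecidableEquality A → ∀ i (xs : List A) x → Dec (At i xs x)
at? _≟_ i []       x = no λ ()
at? _≟_ zero    (y ∷ xs) x = map′ (λ { refl → at-zero }) (λ { at-zero → refl }) (y ≟ x)
at? _≟_ (suc i) (y ∷ xs) x = map′ at-suc (λ { (at-suc p) → p }) (at? _≟_ i xs x)

-- Onto as well, because the graph is connected.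
record Unfolding (K : Graph) (𝒢 : CubicGraph) : Set where
  open CubicGraph 𝒢
  field
    base      : V K
    place     : V K → Vertex
    injective : ∀ x y → place x ≡ place y → x ≡ y
    edges     : ∀ {x y} → E K x y → place y ∈ nb (place x)
    lift      : ∀ x {z} → z ∈ nb (place x) → ∃ λ y → place y ≡ z × E K x y

  onto : ∀ z → ∃ λ x → place x ≡ z
  onto = spread (λ z → ∃ λ x → place x ≡ z)
    (λ { z∈ (x , refl) → let y , e , _ = lift x z∈ in y , e }) (base , refl)

not-≢ : ∀ b → not b ≢ b
not-≢ true  ()
not-≢ false ()

≢⇒≡not : ∀ {a b} → a ≢ b → a ≡ not b
≢⇒≡not {true}  {true}  ne = ⊥-elim (ne refl)
≢⇒≡not {true}  {false} _  = refl
≢⇒≡not {false} {true}  _  = refl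
≢⇒≡not {false} {false} ne = ⊥-elim (ne refl)

triple : ∀ {A : Set} → A → A → A → Fin 3 → A
triple a b c zero             = a
triple a b c (suc zero)       = b
triple a b c (suc (suc zero)) = c

triple-injective : ∀ {A : Set} {a b c : A} → a ≢ b → a ≢ c → b ≢ c →
  ∀ i j → triple a b c i ≡ triple a b c j → i ≡ j
triple-injective a≢b a≢c b≢c zero             zero             _ = refl
triple-injective a≢b a≢c b≢c zero             (suc zero)       e = ⊥-elim (a≢b e)
triple-injective a≢b a≢c b≢c zero             (suc (suc zero)) e = ⊥-elim (a≢c e)
triple-injective a≢b a≢c b≢c (suc zero)       zero             e = ⊥-elim (a≢b (sym e))
triple-injective a≢b a≢c b≢c (suc zero)       (suc zero)       _ = refl
triple-injective a≢b a≢c b≢c (suc zero)       (suc (suc zero)) e = ⊥-elim (b≢c e)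
triple-injective a≢b a≢c b≢c (suc (suc zero)) zero             e = ⊥-elim (a≢c (sym e))
triple-injective a≢b a≢c b≢c (suc (suc zero)) (suc zero)       e = ⊥-elim (b≢c (sym e))
triple-injective a≢b a≢c b≢c (suc (suc zero)) (suc (suc zero)) _ = refl

depth : ∀ {d} → BV d → ℕ
depth top       = 0
depth (sub _ x) = suc (depth x)

-- Valence-2 vertices and their mates

module _ (𝒢 : CubicGraph) where
  open CubicGraph 𝒢

  module Subdividing (hub : ∃ λ t → length (nb t) ≡ 3) (flip : Flippable 𝒢) where

    S : Vertex → Set
    S x = length (nb x) ≡ 2

    S? : ∀ x → Dec (S x)
    S? x = length (nb x) ℕₚ.≟ 2

    S-to : ∀ (φ : Automorphism 𝒢) {x} → let open Automorphism φ in S x → S (to x)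
    S-to φ {x} s = trans (Automorphism.to-valence φ x) s

    S-to⁻ : ∀ (φ : Automorphism 𝒢) {x} → let open Automorphism φ in S (to x) → S x
    S-to⁻ φ {x} s = trans (sym (Automorphism.to-valence φ x)) s

    equal-ends : ∀ {x a b} → S x → a ∈ nb x → b ∈ nb x → length (nb a) ≡ length (nb b)
    equal-ends {x} {a} {b} s a∈ b∈ with a ≟ b
    ... | yes refl = refl
    ... | no a≢b = flip s a∈ b∈ a≢b (_ ℕₚ.≟ _)
      λ φ _ a→b _ → trans (sym (Automorphism.to-valence φ a)) (cong (length ∘ nb) a→b)

    two≤valence : ∀ {x a b} → a ∈ nb x → b ∈ nb x → a ≢ b → 2 ≤ length (nb x)
    two≤valence a∈ b∈ a≢b = unique-⊆-length ((a≢b ∷ []) ∷ [] ∷ [])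
      λ { (here refl) → a∈ ; (there (here refl)) → b∈ }

    -- Otherwise `x` and all its neighbours have valence at most 2, and this spreads: beyond a
    -- vertex of valence 2 the valence equals the one before it, by `equal-ends`. It would reach the
    -- vertex of valence 3 in `hub`.
    S-end : ∀ {x y} → S x → y ∈ nb x → length (nb y) ≡ 3
    S-end {x} {y} s y∈ with length (nb y) ℕₚ.≟ 3
    ... | yes e = e
    ... | no ne = ⊥-elim (<-irrefl refl (subst (_≤ 2) (proj₂ hub) (proj₁ (spread Low low-step low-x (proj₁ hub)))))
      where
      Low : Vertex → Set
      Low z = length (nb z) ≤ 2 × (∀ {w} → w ∈ nb z → length (nb w) ≤ 2)
      low-step : ∀ {z w} → w ∈ nb z → Low z → Low w
      low-step {z} {w} w∈ (lz , lnb) = lnb w∈ , λ {v} v∈ → case v ≟ z of λ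
        { (yes refl) → lz
        ; (no v≢z) → ≤-trans (≤-reflexive (equal-ends (≤-antisym (lnb w∈) (two≤valence v∈ (nb-sym w∈) v≢z)) v∈ (nb-sym w∈))) lz }
      low-x : Low x
      low-x = ≤-reflexive s , λ w∈ → ≤-trans (≤-reflexive (equal-ends s w∈ y∈)) (ℕₚ.≤-pred (ℕₚ.≤∧≢⇒< (nb-≤3 y) ne))

    S-end-≢S : ∀ {x y} → S x → y ∈ nb x → ¬ S y
    S-end-≢S s y∈ s′ with trans (sym (S-end s y∈)) s′
    ... | ()

    other-end : ∀ {x} → S x → ∀ a → ∃ λ b → b ∈ nb x × b ≢ a
    other-end s a = another-neighbour (≤-reflexive (sym s)) a

    -- The two valence-2 corners of a 4-cycle.
    record Mate (x y : Vertex) : Set where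
      constructor mate
      field
        Sˡ       : S x
        Sʳ       : S y
        distinct : x ≢ y
        ends     : ∀ {z} → z ∈ nb x → z ∈ nb y

    mate-sym : ∀ {x y} → Mate x y → Mate y x
    mate-sym {x} {y} (mate s s′ d e) = mate s′ s (≢-sym d) back
      where
      back : ∀ {z} → z ∈ nb y → z ∈ nb x
      back z∈ with other-end s x
      ... | a , a∈ , _ with other-end s a
      ... | b , b∈ , b≢a with two-neighbours s′ (e b∈) (e a∈) b≢a z∈
      ... | inj₁ refl = b∈
      ... | inj₂ refl = a∈

    mate-to : ∀ (φ : Automorphism 𝒢) {x y} → let open Automorphism φ in Mate x y → Mate (to x) (to y)
    mate-to φ {x} {y} (mate s s′ d e) = mate (S-to φ s) (S-to φ s′) (d ∘ to-injective)
      λ {z} z∈ → subst (_∈ nb (to y)) (to-from z)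
        (to-nb (e (to-nb⁻ (subst (_∈ nb (to x)) (sym (to-from z)) z∈))))
      where open Automorphism φ

    Mate? : ∀ x y → Dec (Mate x y)
    Mate? x y = map′ (λ (s , s′ , d , e) → mate s s′ d (λ {z} → e z)) (λ (mate s s′ d e) → s , s′ , d , λ _ → e)
      (S? x ×-dec S? y ×-dec ¬? (x ≟ y) ×-dec ∀∈? (_∈? nb y) (nb x))

    ∃Mate? : ∀ {P : Vertex → Set} → (∀ y → Dec (P y)) → ∀ x → Dec (∃ λ y → Mate x y × P y)
    ∃Mate? P? x = map′ (λ (y , _ , m , q) → y , m , q) (λ (y , m , q) → y , near m , m , q)
      (∃∈? (λ y → Mate? x y ×-dec P? y) (concatMap nb (nb x)))
      where
      near : ∀ {y} → Mate x y → y ∈ concatMap nb (nb x)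
      near m = let a , a∈ , _ = other-end (Mate.Sˡ m) x in ∈-concatMap⁺ nb (lose a∈ (nb-sym (Mate.ends m a∈)))

    SBlack : Vertex → Set
    SBlack x = ∃ λ y → Mate x y × x ≺ y

    SBlack? : ∀ x → Dec (SBlack x)
    SBlack? x = ∃Mate? (x ≺?_) x

    MatesUnique : Set
    MatesUnique = ∀ {x y z} → Mate x y → Mate x z → y ≡ z

    module _ (mates-unique : MatesUnique) where

      mate-black : ∀ {x y} → Mate x y → SBlack x → x ≺ y
      mate-black m (z , m′ , c) with mates-unique m m′
      ... | refl = c

      -- With its ends fixed, a moved `x` would be a mate of its image, and exactly one of two mates
      -- is `SBlack`.
      S-fixed : ∀ (φ : Automorphism 𝒢) {x} → let open Automorphism φ in S x → (∀ {a} → a ∈ nb x → to a ≡ a) →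
        (SBlack x → SBlack (to x)) → (SBlack (to x) → SBlack x) → to x ≡ x
      S-fixed φ {x} s fixed keep keep⁻ with Automorphism.to φ x ≟ x
      ... | yes e = e
      ... | no x≢ = ⊥-elim (clash (≺-total (≢-sym x≢)))
        where
        open Automorphism φ
        m : Mate x (to x)
        m = mate s (S-to φ s) (≢-sym x≢) λ {a} a∈ → subst (_∈ nb (to x)) (fixed a∈) (to-nb a∈)
        clash : x ≺ to x ⊎ to x ≺ x → ⊥
        clash (inj₁ c) = ≺-asym c (mate-black (mate-sym m) (keep (_ , m , c)))
        clash (inj₂ c) = ≺-asym c (mate-black m (keep⁻ (_ , mate-sym m , c)))

    -- A valence-2 vertex v without mate can be made the only black one of its
    -- kind.  Suppressing the valence-2 vertices, v becomes an edge to start the search from.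
    module Lonely (mates-unique : MatesUnique) (v : Vertex) (v-S : S v) (lonely : ∀ y → ¬ Mate v y) where

      Core : Vertex → Set
      Core x = ¬ S x

      through : Vertex → Vertex → Vertex
      through x y with S? y
      ... | yes s = proj₁ (other-end s x)
      ... | no _  = y

      hn : Vertex → List Vertex
      hn x = map (through x) (nb x)

      -- The adjacency computed by `hn`, restated as a relation: in this form its symmetry and its
      -- invariance under automorphisms are visible.
      Linked : Vertex → Vertex → Set
      Linked x y = (¬ S y × y ∈ nb x) ⊎ (∃ λ z → S z × z ∈ nb x × y ∈ nb z × y ≢ x)

      hn⇒linked : ∀ {x y} → y ∈ hn x → Linked x y
      hn⇒linked {x} m with ∈-map⁻ (through x) m
      ... | z , z∈ , refl with S? z
      ... | no ¬s = inj₁ (¬s , z∈)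
      ... | yes s = let _ , m , d = other-end s x in inj₂ (z , s , z∈ , m , d)

      linked⇒hn : ∀ {x y} → Linked x y → y ∈ hn x
      linked⇒hn {x} {y} (inj₁ (¬s , y∈)) = subst (_∈ hn x) through≡ (∈-map⁺ (through x) y∈)
        where
        through≡ : through x y ≡ y
        through≡ with S? y
        ... | yes s = ⊥-elim (¬s s)
        ... | no _ = refl
      linked⇒hn {x} {y} (inj₂ (z , s , z∈ , y∈ , y≢x)) = subst (_∈ hn x) through≡ (∈-map⁺ (through x) z∈)
        where
        through≡ : through x z ≡ y
        through≡ with S? z
        ... | no ¬s = ⊥-elim (¬s s)
        ... | yes s′ with other-end s′ x
        ... | _ , m , d with two-neighbours s y∈ (nb-sym z∈) y≢x m
        ... | inj₁ e = e
        ... | inj₂ e = ⊥-elim (d e)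

      linked-core : ∀ {x y} → Linked x y → Core y
      linked-core (inj₁ (¬s , _)) = ¬s
      linked-core (inj₂ (_ , s , _ , y∈ , _)) = S-end-≢S s y∈

      linked-sym : ∀ {x y} → Core x → Linked x y → Linked y x
      linked-sym cx (inj₁ (_ , y∈)) = inj₁ (cx , nb-sym y∈)
      linked-sym cx (inj₂ (z , s , z∈ , y∈ , y≢x)) = inj₂ (z , s , nb-sym y∈ , nb-sym z∈ , ≢-sym y≢x)

      linked-to : ∀ (φ : Automorphism 𝒢) {x y} → let open Automorphism φ in Linked x y → Linked (to x) (to y)
      linked-to φ (inj₁ (¬s , y∈)) = inj₁ (¬s ∘ S-to⁻ φ , Automorphism.to-nb φ y∈)
      linked-to φ (inj₂ (z , s , z∈ , y∈ , y≢x)) =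
        inj₂ (to z , S-to φ s , to-nb z∈ , to-nb y∈ , y≢x ∘ to-injective)
        where open Automorphism φ

      a b : Vertex
      a = proj₁ (other-end v-S v)
      b = proj₁ (other-end v-S a)

      a∈ : a ∈ nb v
      a∈ = proj₁ (proj₂ (other-end v-S v))

      b∈ : b ∈ nb v
      b∈ = proj₁ (proj₂ (other-end v-S a))

      b≢a : b ≢ a
      b≢a = proj₂ (proj₂ (other-end v-S a))

      -- `spread` also passes through suppressed vertices; there `R` asks for `P` at both ends.
      core-spread : ∀ (P : Vertex → Set) → (∀ {x y} → Core x → y ∈ hn x → P x → P y) →
                    P a → ∀ x → Core x → P x
      core-spread P P-step Pa x = proj₁ (spread R R-step ((λ _ → Pa) , (λ s → ⊥-elim (S-end-≢S v-S a∈ s))) x)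
        where
        R : Vertex → Set
        R z = (¬ S z → P z) × (S z → ∀ {w} → w ∈ nb z → P w)
        R-step : ∀ {z y} → y ∈ nb z → R z → R y
        R-step {z} {y} y∈ (n , s) with S? z
        ... | yes sz = (λ _ → s sz y∈) , λ sy → ⊥-elim (S-end-≢S sz y∈ sy)
        ... | no ¬sz = (λ ¬sy → P-step ¬sz (linked⇒hn (inj₁ (¬sy , y∈))) (n ¬sz)) , beyond
          where
          beyond : S y → ∀ {w} → w ∈ nb y → P w
          beyond sy {w} w∈ with w ≟ z
          ... | yes refl = n ¬sz
          ... | no w≢z = P-step ¬sz (linked⇒hn (inj₂ (y , sy , y∈ , w∈ , w≢z))) (n ¬sz)

      open Levels 𝒢 Core hn (λ _ m → linked-core (hn⇒linked m))
        (λ cx m → linked⇒hn (linked-sym cx (hn⇒linked m)))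
        (λ x → ≤-trans (≤-reflexive (length-map (through x) (nb x))) (nb-≤3 x))
        a b (S-end-≢S v-S a∈) (linked⇒hn (inj₂ (v , v-S , nb-sym a∈ , b∈ , b≢a))) core-spread tiebreak

      Black : Vertex → Set
      Black x = (S x × (x ≡ v ⊎ SBlack x)) ⊎ (¬ S x × CoreBlack x)

      Black? : ∀ x → Dec (Black x)
      Black? x with S? x
      ... | yes s = map′ (λ q → inj₁ (s , q)) (λ { (inj₁ (_ , q)) → q ; (inj₂ (¬s , _)) → ⊥-elim (¬s s) })
                      ((x ≟ v) ⊎-dec SBlack? x)
      ... | no ¬s = map′ (λ q → inj₂ (¬s , q)) (λ { (inj₁ (s , _)) → ⊥-elim (¬s s) ; (inj₂ (_ , q)) → q })
                      (CoreBlack? x ¬s)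

      colouring : TwoColouring 𝒢
      colouring = record { Black = Black ; Black? = Black? }

      module _ (φ : Automorphism 𝒢) (keep : Preserves colouring φ) where

        open Automorphism φ

        black-core : ∀ {x} → Core x → Black x → CoreBlack x
        black-core c (inj₁ (s , _)) = ⊥-elim (c s)
        black-core c (inj₂ (_ , q)) = q

        core-keep : ∀ x → Core x → (CoreBlack x → CoreBlack (to x)) × (CoreBlack (to x) → CoreBlack x)
        core-keep x c = (λ q → black-core (c ∘ S-to⁻ φ) (proj₁ (keep x) (inj₂ (c , q))))
                      , (λ q → black-core c (proj₂ (keep x) (inj₂ (c ∘ S-to⁻ φ , q))))

        -- Any other black vertex of valence 2 has a mate, which pulls back to a mate of `v`.
        fix-v : to v ≡ v
        fix-v with proj₁ (keep v) (inj₁ (v-S , inj₁ refl))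
        ... | inj₁ (_ , inj₁ e) = e
        ... | inj₁ (_ , inj₂ (y , m , _)) =
          ⊥-elim (lonely (from y) (subst (λ w → Mate w (from y)) (from-to v) (mate-to (inverse φ) m)))
        ... | inj₂ (¬s , _) = ⊥-elim (¬s (S-to φ v-S))

        end∈ : ∀ {x} → x ∈ nb v → to x ∈ nb v
        end∈ x∈ = subst (λ w → _ ∈ nb w) fix-v (to-nb x∈)

        fix-a : to a ≡ a
        fix-a with two-neighbours v-S a∈ b∈ (≢-sym b≢a) (end∈ a∈)
        ... | inj₁ e = e
        ... | inj₂ e = ⊥-elim (second-root-white (≢-sym b≢a)
                (subst CoreBlack e (proj₁ (core-keep a (S-end-≢S v-S a∈)) (inj₁ refl))))

        fix-b : to b ≡ b
        fix-b with two-neighbours v-S a∈ b∈ (≢-sym b≢a) (end∈ b∈)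
        ... | inj₁ e = ⊥-elim (b≢a (to-injective (trans e (sym fix-a))))
        ... | inj₂ e = e

        nonS-fixed : ∀ x → ¬ S x → to x ≡ x
        nonS-fixed = core-fixed φ (λ _ m → linked⇒hn (linked-to φ (hn⇒linked m)))
          (λ {x} {y} _ m → linked⇒hn (subst (λ w → Linked w y) (from-to x)
             (subst (Linked _) (from-to y) (linked-to (inverse φ) (hn⇒linked m)))))
          core-keep fix-a fix-b

        black-S : ∀ {x} → S x → x ≢ v → Black x → SBlack x
        black-S s x≢v (inj₁ (_ , inj₁ e)) = ⊥-elim (x≢v e)
        black-S s x≢v (inj₁ (_ , inj₂ q)) = q
        black-S s x≢v (inj₂ (¬s , _)) = ⊥-elim (¬s s)

        fixed : ∀ x → to x ≡ x
        fixed x with S? x | x ≟ v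
        ... | no ¬s | _ = nonS-fixed x ¬s
        ... | yes _ | yes refl = fix-v
        ... | yes s | no x≢v = S-fixed mates-unique φ s (λ a∈ → nonS-fixed _ (S-end-≢S s a∈))
          (λ q → black-S (S-to φ s) (λ e → x≢v (to-injective (trans e (sym fix-v)))) (proj₁ (keep x) (inj₁ (s , inj₂ q))))
          (λ q → black-S s x≢v (proj₂ (keep x) (inj₁ (S-to φ s , inj₂ q))))

      two-distinguishable : TwoDistinguishable 𝒢
      two-distinguishable = colouring , fixed

    -- Three valence-2 vertices with common ends: the graph is K_{2,3}

    module Theta {x y z : Vertex} (xy : Mate x y) (xz : Mate x z) (y≢z : y ≢ z) where

      ends : ∃₂ λ a b → a ∈ nb x × b ∈ nb x × a ≢ b
      ends = let a , a∈ , _ = other-end (Mate.Sˡ xy) x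
                 b , b∈ , b≢a = other-end (Mate.Sˡ xy) a
             in a , b , a∈ , b∈ , ≢-sym b≢a

      corner : Fin 2 → Vertex
      corner zero       = proj₁ ends
      corner (suc zero) = proj₁ (proj₂ ends)

      corner-injective : ∀ i j → corner i ≡ corner j → i ≡ j
      corner-injective zero       zero       _ = refl
      corner-injective zero       (suc zero) e = ⊥-elim (proj₂ (proj₂ (proj₂ (proj₂ ends))) e)
      corner-injective (suc zero) zero       e = ⊥-elim (proj₂ (proj₂ (proj₂ (proj₂ ends))) (sym e))
      corner-injective (suc zero) (suc zero) _ = refl

      middle : Fin 3 → Vertex
      middle = triple x y z

      middle-injective : ∀ i j → middle i ≡ middle j → i ≡ j
      middle-injective = triple-injective (Mate.distinct xy) (Mate.distinct xz) y≢z

      middle-S : ∀ j → S (middle j)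
      middle-S zero             = Mate.Sˡ xy
      middle-S (suc zero)       = Mate.Sʳ xy
      middle-S (suc (suc zero)) = Mate.Sʳ xz

      corner-x : ∀ i → corner i ∈ nb x
      corner-x zero       = proj₁ (proj₂ (proj₂ ends))
      corner-x (suc zero) = proj₁ (proj₂ (proj₂ (proj₂ ends)))

      corner-∈ : ∀ i j → corner i ∈ nb (middle j)
      corner-∈ i zero             = corner-x i
      corner-∈ i (suc zero)       = Mate.ends xy (corner-x i)
      corner-∈ i (suc (suc zero)) = Mate.ends xz (corner-x i)

      place : V K23 → Vertex
      place (inj₁ i) = corner i
      place (inj₂ j) = middle j

      corner-≢-middle : ∀ i j → corner i ≢ middle j
      corner-≢-middle i j e = S-end-≢S (middle-S j) (corner-∈ i j) (subst S (sym e) (middle-S j))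

      injective : ∀ v w → place v ≡ place w → v ≡ w
      injective (inj₁ i) (inj₁ j) e = cong inj₁ (corner-injective i j e)
      injective (inj₁ i) (inj₂ j) e = ⊥-elim (corner-≢-middle i j e)
      injective (inj₂ j) (inj₁ i) e = ⊥-elim (corner-≢-middle i j (sym e))
      injective (inj₂ i) (inj₂ j) e = cong inj₂ (middle-injective i j e)

      edges : ∀ {v w} → K23E v w → place w ∈ nb (place v)
      edges (lr i j) = nb-sym (corner-∈ i j)
      edges (rl i j) = corner-∈ i j

      -- The three middle vertices already fill the corners, and the two corners fill each middle
      -- vertex, so nothing further can be attached.
      lift : ∀ v {w} → w ∈ nb (place v) → ∃ λ w′ → place w′ ≡ w × K23E v w′
      lift (inj₁ i) w∈ with three-neighbours (nb-sym (corner-∈ i zero)) (nb-sym (corner-∈ i (suc zero)))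
          (nb-sym (corner-∈ i (suc (suc zero)))) (Mate.distinct xy) (Mate.distinct xz) y≢z w∈
      ... | inj₁ e = inj₂ zero , sym e , lr i zero
      ... | inj₂ (inj₁ e) = inj₂ (suc zero) , sym e , lr i (suc zero)
      ... | inj₂ (inj₂ e) = inj₂ (suc (suc zero)) , sym e , lr i (suc (suc zero))
      lift (inj₂ j) w∈ with two-neighbours (middle-S j) (corner-∈ zero j) (corner-∈ (suc zero) j)
          (proj₂ (proj₂ (proj₂ (proj₂ ends)))) w∈
      ... | inj₁ e = inj₁ zero , sym e , rl zero j
      ... | inj₂ e = inj₁ (suc zero) , sym e , rl (suc zero) j

      model : Unfolding K23 𝒢
      model = record { base = inj₁ zero ; place = place ; injective = injective ; edges = edges ; lift = lift }

    -- Diamonds: opposite corners and outer neighbours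

    module Diamonds (mates-unique : MatesUnique) (all-mated : ∀ {x} → S x → ∃ (Mate x)) where

      D : Vertex → Set
      D c = ∃ λ s → s ∈ nb c × S s

      D? : ∀ c → Dec (D c)
      D? c = ∃∈? S? (nb c)

      D⇒¬S : ∀ {c} → D c → ¬ S c
      D⇒¬S (s , s∈ , ss) = S-end-≢S ss (nb-sym s∈)

      -- The mate of a neighbour of `c` is again a neighbour of `c`. If `t` were not the mate `m` of
      -- `s`, then `s`, `m`, `t` would be all neighbours of `c`, and the mate of `t` could only be
      -- `s` after all.
      S-near : ∀ {c s t} → s ∈ nb c → t ∈ nb c → S s → S t → s ≢ t → Mate s t
      S-near {c} {s} {t} s∈ t∈ ss st s≢t with all-mated ss | all-mated st
      ... | m , sm | n , tn with t ≟ m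
      ... | yes refl = sm
      ... | no t≢m with three-neighbours s∈ m∈ t∈ (Mate.distinct sm) s≢t (≢-sym t≢m) n∈
        where
        m∈ = nb-sym (Mate.ends sm (nb-sym s∈))
        n∈ = nb-sym (Mate.ends tn (nb-sym t∈))
      ... | inj₁ refl = mate-sym tn
      ... | inj₂ (inj₁ refl) = ⊥-elim (s≢t (mates-unique (mate-sym sm) (mate-sym tn)))
      ... | inj₂ (inj₂ refl) = ⊥-elim (Mate.distinct tn refl)

      -- c and d are opposite corners of a diamond c s d t with s and t of valence 2.
      record Opposite (c d : Vertex) : Set where
        constructor opposite
        field
          distinct : c ≢ d
          via      : Vertex
          via-S    : S via
          via-c    : c ∈ nb via
          via-d    : d ∈ nb via

      opposite-sym : ∀ {c d} → Opposite c d → Opposite d c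
      opposite-sym (opposite ne s ss c∈ d∈) = opposite (≢-sym ne) s ss d∈ c∈

      opposite-to : ∀ (φ : Automorphism 𝒢) {c d} → let open Automorphism φ in Opposite c d → Opposite (to c) (to d)
      opposite-to φ (opposite ne s ss c∈ d∈) = opposite (ne ∘ to-injective) (to s) (S-to φ ss) (to-nb c∈) (to-nb d∈)
        where open Automorphism φ

      opposite-D : ∀ {c d} → Opposite c d → D c
      opposite-D (opposite _ s ss c∈ _) = s , nb-sym c∈ , ss

      opposite-∃ : ∀ {c} → D c → ∃ (Opposite c)
      opposite-∃ {c} (s , s∈ , ss) = let d , d∈ , d≢c = other-end ss c in d , opposite (≢-sym d≢c) s ss (nb-sym s∈) d∈

      -- Distinct valence-2 neighbours of `c` are mates by `S-near`, so all of them lead to the same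
      -- opposite corner.
      opposite-unique : ∀ {c d e} → Opposite c d → Opposite c e → d ≡ e
      opposite-unique {c} {d} {e} (opposite c≢d s ss c∈ d∈) (opposite c≢e t st c∈′ e∈)
        with two-neighbours ss c∈ d∈ c≢d e∈s
        where
        e∈s : e ∈ nb s
        e∈s with s ≟ t
        ... | yes refl = e∈
        ... | no s≢t = Mate.ends (mate-sym (S-near (nb-sym c∈) (nb-sym c∈′) ss st s≢t)) e∈
      ... | inj₁ e≡c = ⊥-elim (c≢e (sym e≡c))
      ... | inj₂ e≡d = sym e≡d

      Plain : Vertex → Vertex → Set
      Plain c q = q ∈ nb c × ¬ S q

      plain-to : ∀ (φ : Automorphism 𝒢) {c q} → let open Automorphism φ in Plain c q → Plain (to c) (to q)
      plain-to φ (q∈ , ¬s) = Automorphism.to-nb φ q∈ , ¬s ∘ S-to⁻ φ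

      -- A corner has valence 3 and two of its neighbours are the mates `s` and `m`; a third one of
      -- valence 2 would be a second mate of `s`.
      plain-∃ : ∀ {c} → D c → ∃ (Plain c)
      plain-∃ {c} (s , s∈ , ss) with all-mated ss
      ... | m , sm with third-neighbour (S-end ss (nb-sym s∈)) s m
      ... | w , w∈ , w≢s , w≢m =
        w , w∈ , λ sw → w≢m (mates-unique (S-near s∈ w∈ ss sw (≢-sym w≢s)) sm)

      plain-unique : ∀ {c q r} → D c → Plain c q → Plain c r → q ≡ r
      plain-unique {c} {q} {r} (s , s∈ , ss) (q∈ , ¬sq) (r∈ , ¬sr) with all-mated ss
      ... | m , sm with three-neighbours s∈ (nb-sym (Mate.ends sm (nb-sym s∈))) q∈ (Mate.distinct sm)
                          (λ { refl → ¬sq ss }) (λ { refl → ¬sq (Mate.Sʳ sm) }) r∈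
      ... | inj₁ refl = ⊥-elim (¬sr ss)
      ... | inj₂ (inj₁ refl) = ⊥-elim (¬sr (Mate.Sʳ sm))
      ... | inj₂ (inj₂ e) = sym e

      D-to : ∀ (φ : Automorphism 𝒢) {c} → let open Automorphism φ in D c → D (to c)
      D-to φ (s , s∈ , ss) = _ , Automorphism.to-nb φ s∈ , S-to φ ss

      D-to⁻ : ∀ (φ : Automorphism 𝒢) {c} → let open Automorphism φ in D (to c) → D c
      D-to⁻ φ {c} d = subst D (Automorphism.from-to φ c) (D-to (inverse φ) d)

      -- Two diamonds joined by an edge: flipping diamonds shows that the whole
      -- graph is a closed or two-way infinite chain of diamonds.
      module Necklace (c q : Vertex) (c-D : D c) (q-D : D q) (cq : Plain c q) where

        Chained : Vertex → Set
        Chained z = D z × (∀ {r} → Plain z r → D r)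

        -- A flip at `s` exchanges `z` and `d`, hence takes the plain neighbour of `z` to that of
        -- `d`. This carries the chain across a diamond.
        chained-opposite : ∀ {z d} → Opposite z d → Chained z → Chained d
        chained-opposite {z} {d} o@(opposite z≢d s ss z∈ d∈) (dz , f) = dd , λ {r} pr →
          flip ss z∈ d∈ z≢d (D? r) λ φ _ z→d _ → let w , pw = plain-∃ dz in
            subst D (plain-unique dd (subst (λ v → Plain v _) z→d (plain-to φ pw)) pr) (D-to φ (f pw))
          where
          dd = opposite-D (opposite-sym o)

        chained : ∀ z → ¬ S z → Chained z
        chained z ¬s with spread R R-step (inj₁ (c-D , λ p → subst D (plain-unique c-D cq p) q-D)) z
          where
          R : Vertex → Set
          R z = Chained z ⊎ (S z × (∀ {w} → w ∈ nb z → Chained w))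
          R-step : ∀ {z y} → y ∈ nb z → R z → R y
          R-step y∈ (inj₂ (_ , f)) = inj₁ (f y∈)
          R-step {z} {y} y∈ (inj₁ h@(dz , f)) with S? y
          ... | no ¬s = inj₁ (f (y∈ , ¬s) , λ pr →
                  subst D (plain-unique (f (y∈ , ¬s)) (nb-sym y∈ , D⇒¬S dz) pr) dz)
          ... | yes s = inj₂ (s , λ {w} w∈ → case z ≟ w of λ
                  { (yes refl) → h
                  ; (no z≢w) → chained-opposite (opposite z≢w y s (nb-sym y∈) w∈) h })
        ... | inj₁ h = h
        ... | inj₂ (s , _) = ⊥-elim (¬s s)

        Black : Vertex → Set
        Black x = x ≡ c ⊎ SBlack x

        colouring : TwoColouring 𝒢
        colouring = record { Black = Black ; Black? = λ x → (x ≟ c) ⊎-dec SBlack? x }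

        module _ (φ : Automorphism 𝒢) (keep : Preserves colouring φ) where

          open Automorphism φ

          fix-c : to c ≡ c
          fix-c with proj₁ (keep c) (inj₁ refl)
          ... | inj₁ e = e
          ... | inj₂ (_ , m , _) = ⊥-elim (D⇒¬S c-D (S-to⁻ φ (Mate.Sˡ m)))

          -- A corner determines its opposite corner and its plain neighbour, so from the fixed `c`
          -- everything follows along the chain.
          nonS-fixed : ∀ z → ¬ S z → to z ≡ z
          nonS-fixed z = proj₁ (spread R R-step ((λ _ → fix-c) , λ s → ⊥-elim (D⇒¬S c-D s)) z)
            where
            R : Vertex → Set
            R z = (¬ S z → to z ≡ z) × (S z → ∀ {w} → w ∈ nb z → to w ≡ w)
            R-step : ∀ {z y} → y ∈ nb z → R z → R y
            R-step {z} {y} y∈ (n , s) with S? z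
            ... | yes sz = (λ _ → s sz y∈) , λ sy → ⊥-elim (S-end-≢S sz y∈ sy)
            ... | no ¬sz = next , beyond
              where
              fz = n ¬sz
              next : ¬ S y → to y ≡ y
              next ¬sy = plain-unique (proj₁ (chained z ¬sz))
                (subst (λ v → Plain v (to y)) fz (plain-to φ (y∈ , ¬sy))) (y∈ , ¬sy)
              beyond : S y → ∀ {w} → w ∈ nb y → to w ≡ w
              beyond sy {w} w∈ with z ≟ w
              ... | yes refl = fz
              ... | no z≢w = opposite-unique (subst (λ v → Opposite v (to w)) fz (opposite-to φ o)) o
                where o = opposite z≢w y sy (nb-sym y∈) w∈

          black-S : ∀ {x} → S x → Black x → SBlack x
          black-S s (inj₁ refl) = ⊥-elim (D⇒¬S c-D s)
          black-S s (inj₂ b) = b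

          fixed : ∀ x → to x ≡ x
          fixed x with S? x
          ... | no ¬s = nonS-fixed x ¬s
          ... | yes s = S-fixed mates-unique φ s (λ a∈ → nonS-fixed _ (S-end-≢S s a∈))
            (λ b → black-S (S-to φ s) (proj₁ (keep x) (inj₂ b)))
            (λ b → black-S s (proj₂ (keep x) (inj₂ b)))

        two-distinguishable : TwoDistinguishable 𝒢
        two-distinguishable = colouring , fixed

      -- Pairwise non-adjacent diamonds and the core graph

      module Separated (separated : ∀ {c q} → D c → Plain c q → ¬ D q) where

        Core : Vertex → Set
        Core x = ¬ S x × ¬ D x

        plain-core : ∀ {c q} → D c → Plain c q → Core q
        plain-core d p = proj₂ p , separated d p

        data Kind (x : Vertex) : Set where
          isS    : S x → Kind x
          isD    : D x → Kind x
          isCore : Core x → Kind x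

        kind : ∀ x → Kind x
        kind x with S? x | D? x
        ... | yes s | _ = isS s
        ... | no _ | yes d = isD d
        ... | no ¬s | no ¬d = isCore (¬s , ¬d)

        core-to : ∀ (φ : Automorphism 𝒢) {x} → let open Automorphism φ in Core x → Core (to x)
        core-to φ (¬s , ¬d) = ¬s ∘ S-to⁻ φ , ¬d ∘ D-to⁻ φ

        far : Vertex → Vertex
        far y with D? y
        ... | yes d = proj₁ (plain-∃ (opposite-D (opposite-sym (proj₂ (opposite-∃ d)))))
        ... | no _  = y

        hn : Vertex → List Vertex
        hn x = map far (nb x)

        -- A diamond counts as an edge between the outer neighbours of its corners, and as a loop if
        -- these coincide.
        data Linked (x y : Vertex) : Set where
          edge    : Core y → y ∈ nb x → Linked x y
          diamond : ∀ {c d} → c ∈ nb x → Opposite c d → Plain d y → Linked x y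

        hn⇒linked : ∀ {x y} → Core x → y ∈ hn x → Linked x y
        hn⇒linked {x} cx m with ∈-map⁻ far m
        ... | z , z∈ , refl with D? z
        ... | no ¬d = edge ((λ s → proj₂ cx (z , z∈ , s)) , ¬d) z∈
        ... | yes d = let _ , o = opposite-∃ d in diamond z∈ o (proj₂ (plain-∃ (opposite-D (opposite-sym o))))

        linked⇒hn : ∀ {x y} → Linked x y → y ∈ hn x
        linked⇒hn {x} {y} (edge cy y∈) = subst (_∈ hn x) far≡ (∈-map⁺ far y∈)
          where
          far≡ : far y ≡ y
          far≡ with D? y
          ... | yes d = ⊥-elim (proj₂ cy d)
          ... | no _ = refl
        linked⇒hn {x} {y} (diamond {c} {d} c∈ o p) = subst (_∈ hn x) far≡ (∈-map⁺ far c∈)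
          where
          far≡ : far c ≡ y
          far≡ with D? c
          ... | no ¬d = ⊥-elim (¬d (opposite-D o))
          ... | yes dc = let _ , o′ = opposite-∃ dc in
            plain-unique (opposite-D (opposite-sym o))
              (subst (λ w → Plain w _) (opposite-unique o′ o) (proj₂ (plain-∃ (opposite-D (opposite-sym o′))))) p

        linked-core : ∀ {x y} → Linked x y → Core y
        linked-core (edge cy _) = cy
        linked-core (diamond _ o p) = plain-core (opposite-D (opposite-sym o)) p

        linked-sym : ∀ {x y} → Core x → Linked x y → Linked y x
        linked-sym cx (edge _ y∈) = edge cx (nb-sym y∈)
        linked-sym cx (diamond c∈ o p) = diamond (nb-sym (proj₁ p)) (opposite-sym o) (nb-sym c∈ , proj₁ cx)

        linked-to : ∀ (φ : Automorphism 𝒢) {x y} → let open Automorphism φ in Linked x y → Linked (to x) (to y)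
        linked-to φ (edge cy y∈) = edge (core-to φ cy) (Automorphism.to-nb φ y∈)
        linked-to φ (diamond c∈ o p) = diamond (Automorphism.to-nb φ c∈) (opposite-to φ o) (plain-to φ p)

        hn-core : ∀ {x y} → Core x → y ∈ hn x → Core y
        hn-core cx m = linked-core (hn⇒linked cx m)

        hn-sym : ∀ {x y} → Core x → y ∈ hn x → x ∈ hn y
        hn-sym cx m = linked⇒hn (linked-sym cx (hn⇒linked cx m))

        hn-≤3 : ∀ x → length (hn x) ≤ 3
        hn-≤3 x = ≤-trans (≤-reflexive (length-map far (nb x))) (nb-≤3 x)

        hn-to : ∀ (φ : Automorphism 𝒢) {x y} → let open Automorphism φ in Core x → y ∈ hn x → to y ∈ hn (to x)
        hn-to φ cx m = linked⇒hn (linked-to φ (hn⇒linked cx m))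

        hn-to⁻ : ∀ (φ : Automorphism 𝒢) {x y} → let open Automorphism φ in Core x → to y ∈ hn (to x) → y ∈ hn x
        hn-to⁻ φ {x} {y} cx m with hn-to (inverse φ) (core-to φ cx) m
        ... | m′ rewrite Automorphism.from-to φ x | Automorphism.from-to φ y = m′

        abstract
          core-spread : ∀ {p} → Core p → ∀ (P : Vertex → Set) → (∀ {x y} → Core x → y ∈ hn x → P x → P y) →
                        P p → ∀ x → Core x → P x
          core-spread {p} cp P P-step Pp x cx = finish (spread R R-step (atCore cp Pp) x)
            where
            -- Outside the core, `P` is remembered at the outer neighbours: of the corner itself in
            -- `atD`, of both adjacent corners in `atS`.
            data R (z : Vertex) : Set where
              atCore : Core z → P z → R z
              atD    : D z → (∀ {q} → Plain z q → P q) → R z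
              atS    : S z → (∀ {c q} → c ∈ nb z → Plain c q → P q) → R z
            R-step : ∀ {z y} → y ∈ nb z → R z → R y
            R-step {z} {y} y∈ r with kind y
            R-step y∈ (atCore cz Pz) | isCore cy = atCore cy (P-step cz (linked⇒hn (edge cy y∈)) Pz)
            R-step y∈ (atCore cz Pz) | isD d = atD d λ p → subst P (plain-unique d (nb-sym y∈ , proj₁ cz) p) Pz
            R-step y∈ (atCore cz Pz) | isS s = ⊥-elim (proj₂ cz (_ , y∈ , s))
            R-step y∈ (atD d f) | isCore cy = atCore cy (f (y∈ , proj₁ cy))
            R-step y∈ (atD d f) | isD d′ = ⊥-elim (separated d (y∈ , D⇒¬S d′) d′)
            R-step {z} {y} y∈ (atD d f) | isS s = atS s beyond
              where
              beyond : ∀ {c q} → c ∈ nb y → Plain c q → P q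
              beyond {c} c∈ p with z ≟ c
              ... | yes refl = f p
              ... | no z≢c = let q₀ , p₀ = plain-∃ d in
                P-step (plain-core d p₀)
                  (linked⇒hn (diamond (nb-sym (proj₁ p₀)) (opposite z≢c y s (nb-sym y∈) c∈) p)) (f p₀)
            R-step y∈ (atS s f) | isCore cy = ⊥-elim (proj₂ cy (_ , nb-sym y∈ , s))
            R-step y∈ (atS s f) | isD d = atD d (f y∈)
            R-step y∈ (atS s f) | isS s′ = ⊥-elim (S-end-≢S s y∈ s′)
            finish : R x → P x
            finish (atCore _ Px) = Px
            finish (atD d _) = ⊥-elim (proj₂ cx d)
            finish (atS s _) = ⊥-elim (proj₁ cx s)

        -- Extends a colouring of the core to the diamonds.  A diamond joining
        -- q ≺ r is recognised by its place in nb q, encoded in the colours of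
        -- its corners as 00, 10 or 01; the pattern 11 is kept for the root diamond.
        module Extend (CoreBlack : Vertex → Set) (CoreBlack? : ∀ x → Core x → Dec (CoreBlack x))
          (Root : Vertex → Set) (Root? : ∀ x → Dec (Root x))
          (root-opposite : ∀ {c d} → Opposite c d → Root c → Root d) where

          -- The condition for `c` to be black, where `q` and `r` are the outer neighbours of `c`
          -- and `d`. The place is always read at the smaller outer neighbour, so `second`, which
          -- colours the corner at the larger one, refers to the place of `d`. Places count from 0;
          -- place 0 leaves both corners white.
          data Pattern (c d q r : Vertex) : Set where
            loop   : q ≡ r → c ≺ d → Pattern c d q r
            first  : q ≺ r → At 1 (nb q) c → Pattern c d q r
            second : r ≺ q → At 2 (nb r) d → Pattern c d q r

          record Spot (c d q r : Vertex) : Set where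
            constructor spot
            field
              opp    : Opposite c d
              plainˡ : Plain c q
              plainʳ : Plain d r

            Dˡ : D c
            Dˡ = opposite-D opp
            Dʳ : D d
            Dʳ = opposite-D (opposite-sym opp)

            swap : Spot d c r q
            swap = record { opp = opposite-sym opp ; plainˡ = plainʳ ; plainʳ = plainˡ }

          open Spot using (Dˡ; Dʳ)

          spot-∃ : ∀ {c} → D c → ∃ λ d → ∃₂ (Spot c d)
          spot-∃ dc = let _ , o = opposite-∃ dc
                          _ , p = plain-∃ dc
                          _ , p′ = plain-∃ (opposite-D (opposite-sym o))
                      in _ , _ , _ , spot o p p′

          DBlack : Vertex → Set
          DBlack c = Root c ⊎ ∃ λ d → ∃₂ λ q r → Spot c d q r × Pattern c d q r

          pattern-of : ∀ {c d q r} → Spot c d q r → ¬ Root c → DBlack c → Pattern c d q r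
          pattern-of s ¬root (inj₁ r₀) = ⊥-elim (¬root r₀)
          pattern-of s@(spot o p p′) ¬root (inj₂ (_ , _ , _ , spot o₁ p₁ p′₁ , pat))
            with refl ← opposite-unique o o₁
            with refl ← plain-unique (Dˡ s) p p₁ | refl ← plain-unique (Dʳ s) p′ p′₁ = pat

          DBlack? : ∀ {c} → D c → Dec (DBlack c)
          DBlack? {c} dc with Root? c | spot-∃ dc
          ... | yes r₀ | _ = yes (inj₁ r₀)
          ... | no ¬root | d , q , r , s = map′ (λ p → inj₂ (d , q , r , s , p)) (pattern-of s ¬root) pattern?
            where
            pattern? : Dec (Pattern c d q r)
            pattern? = map′
              (λ { (inj₁ (e , l)) → loop e l ; (inj₂ (inj₁ (l , a))) → first l a ; (inj₂ (inj₂ (l , a))) → second l a })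
              (λ { (loop e l) → inj₁ (e , l) ; (first l a) → inj₂ (inj₁ (l , a)) ; (second l a) → inj₂ (inj₂ (l , a)) })
              (((q ≟ r) ×-dec (c ≺? d)) ⊎-dec (((q ≺? r) ×-dec at? _≟_ 1 (nb q) c) ⊎-dec ((r ≺? q) ×-dec at? _≟_ 2 (nb r) d)))

          data Black (x : Vertex) : Set where
            blackS : S x → SBlack x → Black x
            blackD : D x → DBlack x → Black x
            blackC : Core x → CoreBlack x → Black x

          black-S : ∀ {x} → S x → Black x → SBlack x
          black-S s (blackS _ b) = b
          black-S s (blackD d _) = ⊥-elim (D⇒¬S d s)
          black-S s (blackC c _) = ⊥-elim (proj₁ c s)

          black-D : ∀ {x} → D x → Black x → DBlack x
          black-D d (blackS s _) = ⊥-elim (D⇒¬S d s)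
          black-D d (blackD _ b) = b
          black-D d (blackC c _) = ⊥-elim (proj₂ c d)

          black-core : ∀ {x} → Core x → Black x → CoreBlack x
          black-core c (blackS s _) = ⊥-elim (proj₁ c s)
          black-core c (blackD d _) = ⊥-elim (proj₂ c d)
          black-core c (blackC _ b) = b

          Black? : ∀ x → Dec (Black x)
          Black? x with kind x
          ... | isS s = map′ (blackS s) (black-S s) (SBlack? x)
          ... | isD d = map′ (blackD d) (black-D d) (DBlack? d)
          ... | isCore c = map′ (blackC c) (black-core c) (CoreBlack? x c)

          colouring : TwoColouring 𝒢
          colouring = record { Black = Black ; Black? = Black? }

          -- One black corner means place 1, the other place 2. So two black corners reveal the root
          -- diamond when its outer neighbours differ.
          not-both : ∀ {c d q r} → q ≢ r → Pattern c d q r → ¬ Pattern d c r q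
          not-both q≢r (loop e _) _ = q≢r e
          not-both q≢r _ (loop e _) = q≢r (sym e)
          not-both q≢r (first l _) (first l′ _) = ≺-asym l l′
          not-both {q = q} q≢r (first _ a) (second _ a′) with at-injective (nb-unique q) a a′
          ... | ()
          not-both {r = r} q≢r (second _ a) (first _ a′) with at-injective (nb-unique r) a a′
          ... | ()
          not-both q≢r (second l _) (second l′ _) = ≺-asym l l′

          module _ (φ : Automorphism 𝒢) (keep : Preserves colouring φ) where

            open Automorphism φ

            core-keep : ∀ x → Core x → (CoreBlack x → CoreBlack (to x)) × (CoreBlack (to x) → CoreBlack x)
            core-keep x c = (λ b → black-core (core-to φ c) (proj₁ (keep x) (blackC c b)))
                          , (λ b → black-core c (proj₂ (keep x) (blackC (core-to φ c) b)))

            D-keep : ∀ {x} → D x → DBlack x → DBlack (to x)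
            D-keep {x} d b = black-D (D-to φ d) (proj₁ (keep x) (blackD d b))

            D-keep⁻ : ∀ {x} → D x → DBlack (to x) → DBlack x
            D-keep⁻ {x} d b = black-D d (proj₂ (keep x) (blackD (D-to φ d) b))

            module _ (core-fixed : ∀ x → Core x → to x ≡ x) (root-fixed : ∀ {c} → Root c → to c ≡ c) where

              spot-to : ∀ {c d q r} → Spot c d q r → Spot (to c) (to d) q r
              spot-to {q = q} {r} s@(spot o p p′) = spot (opposite-to φ o)
                (subst (Plain _) (core-fixed q (plain-core (Dˡ s) p)) (plain-to φ p))
                (subst (Plain _) (core-fixed r (plain-core (Dʳ s) p′)) (plain-to φ p′))

              pattern-keep : ∀ {c d q r} → Spot c d q r → ¬ Root (to c) → Pattern c d q r → Pattern (to c) (to d) q r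
              pattern-keep s ¬root p = pattern-of (spot-to s) ¬root (D-keep (Dˡ s) (inj₂ (_ , _ , _ , s , p)))

              pattern-keep⁻ : ∀ {c d q r} → Spot c d q r → ¬ Root c → Pattern (to c) (to d) q r → Pattern c d q r
              pattern-keep⁻ s ¬root p = pattern-of s ¬root (D-keep⁻ (Dˡ s) (inj₂ (_ , _ , _ , spot-to s , p)))

              -- As `q` is fixed, `c` and its image both lie in `nb q`. Equal colour patterns force
              -- equal places there, and valence at most 3 leaves only the places 0, 1 and 2.
              directed-fixed : ∀ {c d q r} → q ≺ r → Spot c d q r → ¬ Root c → ¬ Root (to c) → to c ≡ c
              directed-fixed {c} {d} {q} {r} q≺r s ¬rc ¬rtc =
                compare (position (nb-sym (proj₁ (Spot.plainˡ s)))) (position (nb-sym (proj₁ (Spot.plainˡ (spot-to s)))))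
                where
                ¬rd : ¬ Root d
                ¬rd = ¬rc ∘ root-opposite (opposite-sym (Spot.opp s))
                ¬rtd : ¬ Root (to d)
                ¬rtd = ¬rtc ∘ root-opposite (opposite-sym (Spot.opp (spot-to s)))
                at₁ : ∀ {c d} → Pattern c d q r → At 1 (nb q) c
                at₁ (loop refl _) = ⊥-elim (≺-asym q≺r q≺r)
                at₁ (first _ a) = a
                at₁ (second l _) = ⊥-elim (≺-asym q≺r l)
                at₂ : ∀ {c d} → Pattern d c r q → At 2 (nb q) c
                at₂ (loop refl _) = ⊥-elim (≺-asym q≺r q≺r)
                at₂ (first l _) = ⊥-elim (≺-asym q≺r l)
                at₂ (second _ a) = a
                compare : (∃ λ i → i < length (nb q) × At i (nb q) c) →
                          (∃ λ i → i < length (nb q) × At i (nb q) (to c)) → to c ≡ c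
                compare (0 , _ , a) (0 , _ , b) = at-functional b a
                compare (1 , _ , a) _ = at-functional (at₁ (pattern-keep s ¬rtc (first q≺r a))) a
                compare _ (1 , _ , b) = at-functional b (at₁ (pattern-keep⁻ s ¬rc (first q≺r b)))
                compare (2 , _ , a) _ = at-functional (at₂ (pattern-keep (Spot.swap s) ¬rtd (second q≺r a))) a
                compare _ (2 , _ , b) = at-functional b (at₂ (pattern-keep⁻ (Spot.swap s) ¬rd (second q≺r b)))
                compare (suc (suc (suc i)) , i< , _) _ = ⊥-elim (<⇒≱ i< (≤-trans (nb-≤3 q) (s≤s (s≤s (s≤s z≤n)))))
                compare _ (suc (suc (suc i)) , i< , _) = ⊥-elim (<⇒≱ i< (≤-trans (nb-≤3 q) (s≤s (s≤s (s≤s z≤n)))))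

              -- An exchange of the two corners is excluded by their colours; any other image would
              -- be a second loop at `q`, giving `q` four neighbours.
              loop-fixed : ∀ {c d q} → Spot c d q q → ¬ Root c → ¬ Root (to c) → to c ≡ c
              loop-fixed {c} {d} {q} s ¬rc ¬rtc with to c ≟ c | to c ≟ d
              ... | yes e | _ = e
              ... | no c≢ | yes e = ⊥-elim (clash (≺-total (Opposite.distinct o)))
                where
                o = Spot.opp s
                td≡c : to d ≡ c
                td≡c = opposite-unique (subst (λ w → Opposite w (to d)) e (opposite-to φ o)) (opposite-sym o)
                order : ∀ {c d} → Pattern c d q q → c ≺ d
                order (loop _ l) = l
                order (first l _) = ⊥-elim (≺-asym l l)
                order (second l _) = ⊥-elim (≺-asym l l)
                clash : c ≺ d ⊎ d ≺ c → ⊥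
                clash (inj₁ l) = ≺-asym l (subst (_≺ c) e (subst (to c ≺_) td≡c (order (pattern-keep s ¬rtc (loop refl l)))))
                clash (inj₂ l) = ≺-asym l (order (pattern-keep⁻ s ¬rc
                  (loop refl (subst (to c ≺_) (sym td≡c) (subst (_≺ c) (sym e) l)))))
              ... | no c≢ | no tc≢d = ⊥-elim (no-four (nb-≤3 q) (up s) (up (Spot.swap s)) (up (spot-to s)) (up (Spot.swap (spot-to s)))
                  (Opposite.distinct o) (≢-sym c≢)
                  (λ c≡ → tc≢d (sym (opposite-unique o (subst (λ w → Opposite w (to c)) (sym c≡) (opposite-sym o′)))))
                  (≢-sym tc≢d)
                  (λ d≡ → c≢ (sym (opposite-unique (opposite-sym o) (subst (λ w → Opposite w (to c)) (sym d≡) (opposite-sym o′)))))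
                  (Opposite.distinct o′))
                where
                o = Spot.opp s
                o′ = Spot.opp (spot-to s)
                up : ∀ {c d q r} → Spot c d q r → c ∈ nb q
                up s = nb-sym (proj₁ (Spot.plainˡ s))

              D-fixed : ∀ {c} → D c → to c ≡ c
              D-fixed {c} dc with Root? c | Root? (to c) | spot-∃ dc
              ... | yes r₀ | _ | _ = root-fixed r₀
              ... | no _ | yes r₀ | _ = to-injective (root-fixed r₀)
              ... | no ¬rc | no ¬rtc | d , q , r , s with q ≟ r
              ... | yes refl = loop-fixed s ¬rc ¬rtc
              ... | no q≢r with ≺-total q≢r
              ... | inj₁ l = directed-fixed l s ¬rc ¬rtc
              -- The pattern is read at the smaller end, here next to `d`; `c` follows as the
              -- opposite of the fixed `d`.
              ... | inj₂ l = opposite-unique (subst (λ w → Opposite w (to c)) d-fixed (opposite-to φ o)) o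
                where
                o = opposite-sym (Spot.opp s)
                d-fixed : to d ≡ d
                d-fixed = directed-fixed l (Spot.swap s) (¬rc ∘ root-opposite o) (¬rtc ∘ root-opposite (opposite-to φ o))

              all-fixed : ∀ x → to x ≡ x
              all-fixed x with kind x
              ... | isCore c = core-fixed x c
              ... | isD d = D-fixed d
              ... | isS s = S-fixed mates-unique φ s (λ a∈ → D-fixed (x , nb-sym a∈ , s))
                (λ b → black-S (S-to φ s) (proj₁ (keep x) (blackS s b)))
                (λ b → black-S s (proj₂ (keep x) (blackS (S-to φ s) b)))

        NoRoot : Vertex → Set
        NoRoot _ = ⊥

        NoRoot? : ∀ x → Dec (NoRoot x)
        NoRoot? _ = no λ ()

        no-root-opposite : ∀ {c d} → Opposite c d → NoRoot c → NoRoot d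
        no-root-opposite _ ()

        -- A diamond whose plain neighbours a′ and b′ differ is an edge of the
        -- core graph to start the search from.
        module Bridge {a b a′ b′ : Vertex} (o : Opposite a b) (pa : Plain a a′) (pb : Plain b b′) (a′≢b′ : a′ ≢ b′) where

          a-D : D a
          a-D = opposite-D o

          b-D : D b
          b-D = opposite-D (opposite-sym o)

          open Levels 𝒢 Core hn hn-core hn-sym hn-≤3 a′ b′ (plain-core a-D pa)
            (linked⇒hn (diamond (nb-sym (proj₁ pa)) o pb)) (core-spread (plain-core a-D pa)) tiebreak

          Root : Vertex → Set
          Root c = c ≡ a ⊎ c ≡ b

          root-opposite : ∀ {c d} → Opposite c d → Root c → Root d
          root-opposite o′ (inj₁ refl) = inj₂ (opposite-unique o′ o)
          root-opposite o′ (inj₂ refl) = inj₁ (opposite-unique o′ (opposite-sym o))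

          Root? : ∀ c → Dec (Root c)
          Root? c = (c ≟ a) ⊎-dec (c ≟ b)

          open Extend CoreBlack CoreBlack? Root Root? root-opposite

          module _ (φ : Automorphism 𝒢) (keep : Preserves colouring φ) where

            open Automorphism φ

            s : Spot (to a) (to b) (to a′) (to b′)
            s = spot (opposite-to φ o) (plain-to φ pa) (plain-to φ pb)

            -- Both corners of the image diamond are black, which `not-both` rules out away from the
            -- root diamond.
            root-a : Root (to a)
            root-a = decidable-stable (Root? (to a)) λ ¬ra → not-both (a′≢b′ ∘ to-injective)
              (pattern-of s ¬ra (D-keep φ keep a-D (inj₁ (inj₁ refl))))
              (pattern-of (Spot.swap s) (¬ra ∘ root-opposite (opposite-sym (Spot.opp s)))
                (D-keep φ keep b-D (inj₁ (inj₂ refl))))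

            black-a′ : CoreBlack (to a′)
            black-a′ = proj₁ (core-keep φ keep a′ (plain-core a-D pa)) (inj₁ refl)

            a′-stays : to a′ ≢ b′
            a′-stays e = second-root-white a′≢b′ (subst CoreBlack e black-a′)

            -- Reversing the root diamond would send the black `a′` to the white `b′`.
            a→b-impossible : to a ≢ b
            a→b-impossible e = a′-stays (plain-unique b-D (subst (λ w → Plain w (to a′)) e (plain-to φ pa)) pb)

            fix-a : to a ≡ a
            fix-a = [ id , ⊥-elim ∘ a→b-impossible ]′ root-a

            fix-b : to b ≡ b
            fix-b = opposite-unique (subst (λ w → Opposite w (to b)) fix-a (opposite-to φ o)) o

            fix-plain : ∀ {c q} → D c → Plain c q → to c ≡ c → to q ≡ q
            fix-plain {q = q} d p e = plain-unique d (subst (λ w → Plain w (to q)) e (plain-to φ p)) p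

            fixed : ∀ x → to x ≡ x
            fixed = all-fixed φ keep
              (core-fixed φ (hn-to φ) (hn-to⁻ φ) (core-keep φ keep) (fix-plain a-D pa fix-a) (fix-plain b-D pb fix-b))
              (λ { (inj₁ refl) → fix-a ; (inj₂ refl) → fix-b })

          two-distinguishable : TwoDistinguishable 𝒢
          two-distinguishable = colouring , fixed

        -- Diamonds with a single outer neighbour: trees built up from the leaves

        module Looped (looped : ∀ {c d q} → Opposite c d → Plain c q → Plain d q) where

          -- Each corner at `q` brings its opposite corner along, so a third one would mean four
          -- neighbours.
          no-third-D : ∀ {q c d e} → Opposite c d → Plain c q → Plain e q → D e → e ≢ c → e ≢ d → ⊥
          no-third-D {q} {c} {d} {e} o pc pe de e≢c e≢d =
            let f , o′ = opposite-∃ de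
                up : ∀ {c} → Plain c q → c ∈ nb q
                up p = nb-sym (proj₁ p)
            in no-four (nb-≤3 q) (up pc) (up (looped o pc)) (up pe) (up (looped o′ pe))
                 (Opposite.distinct o) (≢-sym e≢c)
                 (λ { refl → e≢d (opposite-unique (opposite-sym o′) o) })
                 (≢-sym e≢d)
                 (λ { refl → e≢c (opposite-unique (opposite-sym o′) (opposite-sym o)) })
                 (Opposite.distinct o′)

          core-valence : ∀ {x a b} → Core x → a ∈ nb x → b ∈ nb x → a ≢ b → length (nb x) ≡ 3
          core-valence {x} (¬s , _) a∈ b∈ a≢b = ≤-antisym (nb-≤3 x) (ℕₚ.≤∧≢⇒< (two≤valence a∈ b∈ a≢b) (≢-sym ¬s))

          -- Tree n p u: p without its neighbour u spans a full binary tree of depth n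
          -- whose leaves are corners of diamonds.
          data Tree : ℕ → Vertex → Vertex → Set where
            tip  : ∀ {c w} → D c → Plain c w → Tree 0 c w
            fork : ∀ {n p u} → Core p → length (nb p) ≡ 3 → u ∈ nb p →
                   (∀ q → q ∈ nb p → q ≢ u → Tree n q p) → Tree (suc n) p u

          Tree? : ∀ n p u → Dec (Tree n p u)
          Tree? zero c w = map′ (λ (d , p) → tip d p) (λ { (tip d p) → d , p }) (D? c ×-dec (w ∈? nb c) ×-dec ¬? (S? w))
          Tree? (suc n) p u = map′ (λ (c , l , m , f) → fork c l m f) (λ { (fork c l m f) → c , l , m , f })
            ((¬? (S? p) ×-dec ¬? (D? p)) ×-dec (length (nb p) ℕₚ.≟ 3) ×-dec (u ∈? nb p)
              ×-dec ∀∈? (λ q → ¬? (q ≟ u) →-dec Tree? n q p) (nb p))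

          tree-∈ : ∀ {n p u} → Tree n p u → u ∈ nb p
          tree-∈ (tip _ (w∈ , _)) = w∈
          tree-∈ (fork _ _ u∈ _)  = u∈

          tree-core : ∀ {n p u} → Tree (suc n) p u → Core p
          tree-core (fork c _ _ _) = c

          tree-child : ∀ {n p u q} → Tree (suc n) p u → q ∈ nb p → q ≢ u → Tree n q p
          tree-child (fork _ _ _ f) = f _

          tree-third : ∀ {n p u} → Tree (suc n) p u → ∀ v → ∃ λ q → q ∈ nb p × q ≢ u × q ≢ v
          tree-third {u = u} (fork _ l _ _) v = third-neighbour l u v

          tree-to : ∀ (φ : Automorphism 𝒢) {n p u} → let open Automorphism φ in Tree n p u → Tree n (to p) (to u)
          tree-to φ (tip d p) = tip (D-to φ d) (plain-to φ p)
          tree-to φ {suc n} {p} {u} (fork c l u∈ f) = fork (core-to φ c) (trans (to-valence p) l) (to-nb u∈) children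
            where
            open Automorphism φ
            children : ∀ q → q ∈ nb (to p) → q ≢ to u → Tree n q (to p)
            children q q∈ q≢ = subst (λ w → Tree n w (to p)) (to-from q)
              (tree-to φ (f (from q) (to-nb⁻ (subst (_∈ nb (to p)) (sym (to-from q)) q∈))
                            λ e → q≢ (trans (sym (to-from q)) (cong to e))))

          tree-height : ∀ {n m p u} → Tree n p u → Tree m p u → n ≡ m
          tree-height (tip _ _) (tip _ _) = refl
          tree-height (tip d _) (fork c _ _ _) = ⊥-elim (proj₂ c d)
          tree-height (fork c _ _ _) (tip d _) = ⊥-elim (proj₂ c d)
          tree-height {suc n} {suc m} {p} {u} t@(fork _ _ _ f) (fork _ _ _ g) =
            let q , q∈ , q≢ , _ = tree-third t u in cong suc (tree-height (f q q∈ q≢) (g q q∈ q≢))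

          Center : ℕ → Vertex → Set
          Center n r = Core r × length (nb r) ≡ 3 × (∀ {q} → q ∈ nb r → Tree n q r)

          -- Seen from `w`, the vertex `u` hangs below `p`, and conversely. The third neighbour
          -- hangs below `p` in both views and forces equal heights, so `p` is a centre.
          two-parents : ∀ {n m p u w} → Tree n p u → Tree m p w → u ≢ w → n ≡ m × ∃ λ k → n ≡ suc k × Center k p
          two-parents (tip d p) (tip _ p′) u≢w = ⊥-elim (u≢w (plain-unique d p p′))
          two-parents (tip d _) (fork c _ _ _) _ = ⊥-elim (proj₂ c d)
          two-parents (fork c _ _ _) (tip d _) _ = ⊥-elim (proj₂ c d)
          two-parents {suc n} {suc m} {p} {u} {w} t@(fork c l _ f) (fork _ _ _ g) u≢w
            with tree-third t w
          ... | z , z∈ , z≢u , z≢w with tree-height (f z z∈ z≢u) (g z z∈ z≢w)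
          ... | refl = refl , n , refl , c , l , λ {q} q∈ → case q ≟ u of λ
            { (yes refl) → g q q∈ u≢w ; (no q≢u) → f q q∈ q≢u }

          Sibling : ℕ → Vertex → Vertex → Vertex → Set
          Sibling n x t y = y ∈ nb t × y ≢ x × Tree n y t

          -- A second parent would make `x` a centre, with `t` among its subtrees. Then `y`, lying
          -- below `t`, would have height two less than as a sibling of `x`; if `t` is a corner, `x`
          -- and `y` would be two plain neighbours of it.
          parent-unique : ∀ {n m x t w y} → Tree n x t → Sibling n x t y → Tree m x w → n ≡ m × t ≡ w
          parent-unique {t = t} {w} tr (y∈ , y≢x , ty) tr′ with t ≟ w
          ... | yes refl = tree-height tr tr′ , refl
          ... | no t≢w with two-parents tr tr′ t≢w
          ... | refl , k , refl , _ , _ , all with all (tree-∈ tr)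
          ... | tip dt _ = ⊥-elim (y≢x (plain-unique dt (y∈ , proj₁ (tree-core ty)) (nb-sym (tree-∈ tr) , proj₁ (tree-core tr))))
          ... | fork _ _ _ f = ⊥-elim (ℕₚ.m≢1+m+n _ (trans (tree-height (f _ y∈ y≢x) ty) (cong suc (sym (trans (+-suc _ 0) (cong suc (+-identityʳ _)))))))

          -- Were `u` a corner, its opposite would share the outer neighbour `p` and thus be a child
          -- of `p`, of height 0. The other child would then be a corner as well, against
          -- `no-third-D`.
          parent-core : ∀ {n p u} → Tree n p u → Core u
          parent-core (tip d p) = plain-core d p
          parent-core {suc n} {p} {u} t@(fork c _ u∈ f) = (λ s → proj₂ c (u , u∈ , s)) , not-D
            where
            not-D : ¬ D u
            not-D du with opposite-∃ du
            ... | d , o = crowded (f d (nb-sym (proj₁ pd)) (≢-sym (Opposite.distinct o)))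
              where
              pu : Plain u p
              pu = nb-sym u∈ , proj₁ c
              pd : Plain d p
              pd = looped o pu
              crowded : ∀ {k} → Tree k d p → ⊥
              crowded (fork cd _ _ _) = proj₂ cd (opposite-D (opposite-sym o))
              crowded (tip _ _) with tree-third t d
              ... | z , z∈ , z≢u , z≢d with f z z∈ z≢u
              ... | tz with tree-height (f d (nb-sym (proj₁ pd)) (≢-sym (Opposite.distinct o))) (tip (opposite-D (opposite-sym o)) pd)
              ... | refl with tz
              ... | tip dz pz = no-third-D o pu pz dz z≢u z≢d

          tip-sibling : ∀ {c w} → Tree 0 c w → ∃ (Sibling 0 c w)
          tip-sibling (tip d p) = let e , o = opposite-∃ d in
            e , nb-sym (proj₁ (looped o p)) , ≢-sym (Opposite.distinct o) , tip (opposite-D (opposite-sym o)) (looped o p)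

          grow : ∀ {n x t y} → Tree n x t → Sibling n x t y → ∃ (Tree (suc n) t)
          grow {n} {x} {t} {y} tr (y∈ , y≢x , ty) with core-valence (parent-core tr) (nb-sym (tree-∈ tr)) y∈ (≢-sym y≢x)
          ... | l with third-neighbour l x y
          ... | w , w∈ , w≢x , w≢y = w , fork (parent-core tr) l w∈ λ q q∈ q≢w →
            case three-neighbours (nb-sym (tree-∈ tr)) y∈ w∈ (≢-sym y≢x) (≢-sym w≢x) (≢-sym w≢y) q∈ of λ
              { (inj₁ refl) → tr ; (inj₂ (inj₁ refl)) → ty ; (inj₂ (inj₂ e)) → ⊥-elim (q≢w e) }

          linked-edge : ∀ {x y} → Core x → y ∈ hn x → y ≡ x ⊎ (Core y × y ∈ nb x)
          linked-edge cx m with hn⇒linked cx m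
          ... | edge cy y∈ = inj₂ (cy , y∈)
          ... | diamond c∈ o p = inj₁ (plain-unique (opposite-D (opposite-sym o)) p (looped o (nb-sym c∈ , proj₁ cx)))

          module NoCenter (no-center : ∀ {n r} → ¬ Center n r) where

            -- Two siblings of `x` would make the parent a centre.
            sibling-unique : ∀ {n x t y z} → Tree n x t → Sibling n x t y → Sibling n x t z → y ≡ z
            sibling-unique {n} {x} {t} {y} {z} tr (y∈ , y≢x , ty) (z∈ , z≢x , tz) with y ≟ z
            ... | yes e = e
            ... | no y≢z = ⊥-elim (no-center (parent-core tr , core-valence (parent-core tr) y∈ z∈ y≢z , λ q∈ →
                    case three-neighbours (nb-sym (tree-∈ tr)) y∈ z∈ (≢-sym y≢x) (≢-sym z≢x) y≢z q∈ of λ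
                      { (inj₁ refl) → tr ; (inj₂ (inj₁ refl)) → ty ; (inj₂ (inj₂ refl)) → tz }))

            -- Every tree has a sibling, so that G is exhausted by an increasing
            -- sequence of trees.  Colouring siblings differently suffices: x and its
            -- image have a common ancestor, which is fixed as both have the same height.
            module Canopy (sibling : ∀ {n x t} → Tree n x t → ∃ (Sibling n x t)) (c : Vertex) (c-D : D c) where

              parents-agree : ∀ {n m x t w} → Tree n x t → Tree m x w → n ≡ m × t ≡ w
              parents-agree tr = parent-unique tr (proj₂ (sibling tr))

              abstract
                tall : ∀ x → Core x → ∃₂ λ n t → Tree (suc n) x t
                tall = core-spread (parent-core base) P P-step (0 , grow base (proj₂ (sibling base)))
                  where
                  base : Tree 0 c (proj₁ (plain-∃ c-D))
                  base = tip c-D (proj₂ (plain-∃ c-D))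
                  P : Vertex → Set
                  P x = ∃₂ λ n t → Tree (suc n) x t
                  P-step : ∀ {x y} → Core x → y ∈ hn x → P x → P y
                  P-step {x} {y} cx m (n , t , tr) with linked-edge cx m
                  ... | inj₁ refl = n , t , tr
                  ... | inj₂ (cy , y∈) with y ≟ t
                  ... | yes refl = suc n , grow tr (proj₂ (sibling tr))
                  ... | no y≢t with tree-child tr y∈ y≢t
                  ... | tip d _ = ⊥-elim (proj₂ cy d)
                  ... | tr′@(fork _ _ _ _) = _ , _ , tr′

              CoreBlack : Vertex → Set
              CoreBlack x = ∃₂ λ n t → Tree n x t × ∃ λ y → Sibling n x t y × x ≺ y

              CoreBlack? : ∀ x → Core x → Dec (CoreBlack x)
              CoreBlack? x cx with tall x cx
              ... | n , t , tr = map′ (λ (y , y∈ , (y≢x , ty) , l) → suc n , t , tr , y , (y∈ , y≢x , ty) , l) bound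
                (∃∈? (λ y → (¬? (y ≟ x) ×-dec Tree? (suc n) y t) ×-dec (x ≺? y)) (nb t))
                where
                bound : CoreBlack x → ∃ λ y → y ∈ nb t × (y ≢ x × Tree (suc n) y t) × x ≺ y
                bound (_ , _ , tr′ , y , (y∈ , y≢x , ty) , l) with parents-agree tr tr′
                ... | refl , refl = y , y∈ , (y≢x , ty) , l

              sibling-black : ∀ {n x t y} → Tree n x t → Sibling n x t y → CoreBlack x → x ≺ y
              sibling-black tr s (_ , _ , tr′ , _ , s′ , l) with parents-agree tr tr′
              ... | refl , refl with sibling-unique tr s s′
              ... | refl = l

              data Up : ℕ → Vertex → Vertex → Set where
                stop  : ∀ {x} → Up 0 x x
                climb : ∀ {n i x t z} → Tree n x t → Up i t z → Up (suc i) x z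

              up-functional : ∀ {i x z z′} → Up i x z → Up i x z′ → z ≡ z′
              up-functional stop stop = refl
              up-functional (climb tr p) (climb tr′ p′) with parents-agree tr tr′
              ... | _ , refl = up-functional p p′

              up-snoc : ∀ {i x z n t} → Up i x z → Tree n z t → Up (suc i) x t
              up-snoc stop tr = climb tr stop
              up-snoc (climb tr′ p) tr = climb tr′ (up-snoc p tr)

              abstract
                up-height : ∀ {i x z n t} → Up i x z → Tree n x t → ∃ (Tree (i + n) z)
                up-height stop tr = _ , tr
                up-height {suc i} {z = z} {n} (climb tr p) tr′ with parents-agree tr tr′
                ... | refl , refl = let _ , up = grow tr (proj₂ (sibling tr))
                                        w , h = up-height p up
                                    in w , subst (λ k → Tree k z w) (+-suc i n) h

              Related : Vertex → Vertex → Set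
              Related x y = ∃₂ λ i j → ∃ λ z → Up i x z × Up j y z

              related-step : ∀ {x y w} → Core y → w ∈ hn y → Related x y → Related x w
              related-step {x} {y} {w} cy m (i , j , z , p , q) with linked-edge cy m
              ... | inj₁ refl = i , j , z , p , q
              ... | inj₂ (cw , w∈) with tall y cy
              ... | _ , t , tr with w ≟ t
              ... | no w≢t = i , suc j , z , p , climb (tree-child tr w∈ w≢t) q
              -- A step to the parent of `y` lengthens the ascent of `x` if `y` is the common
              -- ancestor, and otherwise shortens that of `y`.
              related-step cy m (i , 0 , z , p , stop) | inj₂ _ | _ , _ , tr | yes refl = suc i , 0 , _ , up-snoc p tr , stop
              related-step cy m (i , suc j , z , p , climb tr′ q) | inj₂ _ | _ , _ , tr | yes refl
                with parents-agree tr tr′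
              ... | _ , refl = i , j , z , p , q

              abstract
                common-ancestor : ∀ {x} → Core x → ∀ y → Core y → Related x y
                common-ancestor {x} cx = core-spread cx (Related x) related-step (0 , 0 , x , stop , stop)

              open Extend CoreBlack CoreBlack? NoRoot NoRoot? no-root-opposite

              module _ (φ : Automorphism 𝒢) (keep : Preserves colouring φ) where

                open Automorphism φ

                up-to : ∀ {i x z} → Up i x z → Up i (to x) (to z)
                up-to stop = stop
                up-to (climb tr p) = climb (tree-to φ tr) (up-to p)

                child-fixed : ∀ {n x t} → Core x → Tree n x t → to t ≡ t → to x ≡ x
                child-fixed {n} {x} {t} cx tr ft with to x ≟ x
                ... | yes e = e
                ... | no x≢ = ⊥-elim (clash (≺-total (≢-sym x≢)))
                  where
                  tr′ : Tree n (to x) t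
                  tr′ = subst (Tree n (to x)) ft (tree-to φ tr)
                  s : Sibling n x t (to x)
                  s = nb-sym (tree-∈ tr′) , x≢ , tr′
                  s′ : Sibling n (to x) t x
                  s′ = nb-sym (tree-∈ tr) , ≢-sym x≢ , tr
                  clash : x ≺ to x ⊎ to x ≺ x → ⊥
                  clash (inj₁ l) = ≺-asym l (sibling-black tr′ s′ (proj₁ (core-keep φ keep x cx) (_ , _ , tr , _ , s , l)))
                  clash (inj₂ l) = ≺-asym l (sibling-black tr s (proj₂ (core-keep φ keep x cx) (_ , _ , tr′ , _ , s′ , l)))

                descend : ∀ {i x z} → Core x → Up i x z → to z ≡ z → to x ≡ x
                descend cx stop fz = fz
                descend cx (climb tr p) fz = child-fixed cx tr (descend (parent-core tr) p fz)

                core-fixed : ∀ x → Core x → to x ≡ x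
                core-fixed x cx with common-ancestor cx (to x) (core-to φ cx) | tall x cx
                ... | i , j , z , p , q | n , t , tr with up-height p tr | up-height q (tree-to φ tr)
                ... | _ , h | _ , h′ with ℕₚ.+-cancelʳ-≡ (suc n) i j (proj₁ (parents-agree h h′))
                ... | refl = descend cx p (up-functional (up-to p) q)

                fixed : ∀ x → to x ≡ x
                fixed = all-fixed φ keep core-fixed λ ()

              two-distinguishable : TwoDistinguishable 𝒢
              two-distinguishable = colouring , fixed

            -- A tree of depth n + 1 at p without a sibling.  Such trees can be coloured
            -- white at their root, by preference over their twins, except for p itself.
            module Unpaired (n : ℕ) (p u : Vertex) (tr : Tree (suc n) p u)
              (alone : ∀ {y} → ¬ Sibling (suc n) p u y) where

              p-core : Core p
              p-core = tree-core tr

              u-core : Core u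
              u-core = parent-core tr

              Single : Vertex → Vertex → Set
              Single q t = Tree (suc n) q t × (∀ r → r ∈ nb t → r ≢ q → ¬ Tree (suc n) r t)

              Preferred : Vertex → Set
              Preferred q = ∃ λ t → t ∈ nb q × Single q t

              Preferred? : ∀ q → Dec (Preferred q)
              Preferred? q = ∃∈? (λ t → Tree? (suc n) q t ×-dec ∀∈? (λ r → ¬? (r ≟ q) →-dec ¬? (Tree? (suc n) r t)) (nb t)) (nb q)

              -- The lesser of two twins is coloured black, so preferred vertices are ranked higher
              -- in order to stay white.
              data _⊲_ (x y : Vertex) : Set where
                prefer : ¬ Preferred x → Preferred y → x ⊲ y
                tie    : (Preferred x → Preferred y) → (Preferred y → Preferred x) → x ≺ y → x ⊲ y

              preference : Tiebreak Vertex
              preference = record { _≺_ = _⊲_ ; _≺?_ = ⊲? ; ≺-asym = asym ; ≺-total = total }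
                where
                ⊲? : ∀ x y → Dec (x ⊲ y)
                ⊲? x y = map′
                  (λ { (inj₁ (¬px , py)) → prefer ¬px py ; (inj₂ ((f , g) , l)) → tie f g l })
                  (λ { (prefer ¬px py) → inj₁ (¬px , py) ; (tie f g l) → inj₂ ((f , g) , l) })
                  ((¬? (Preferred? x) ×-dec Preferred? y)
                    ⊎-dec (((Preferred? x →-dec Preferred? y) ×-dec (Preferred? y →-dec Preferred? x)) ×-dec (x ≺? y)))
                asym : ∀ {x y} → x ⊲ y → ¬ y ⊲ x
                asym (prefer ¬px _) (prefer _ px) = ¬px px
                asym (prefer ¬px py) (tie f _ _) = ¬px (f py)
                asym (tie f _ _) (prefer ¬py px) = ¬py (f px)
                asym (tie _ _ l) (tie _ _ l′) = ≺-asym l l′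
                total : ∀ {x y} → x ≢ y → x ⊲ y ⊎ y ⊲ x
                total {x} {y} x≢y with Preferred? x | Preferred? y
                ... | yes px | no ¬py = inj₂ (prefer ¬py px)
                ... | no ¬px | yes py = inj₁ (prefer ¬px py)
                ... | yes px | yes py with ≺-total x≢y
                ... | inj₁ l = inj₁ (tie (λ _ → py) (λ _ → px) l)
                ... | inj₂ l = inj₂ (tie (λ _ → px) (λ _ → py) l)
                total {x} {y} x≢y | no ¬px | no ¬py with ≺-total x≢y
                ... | inj₁ l = inj₁ (tie (⊥-elim ∘ ¬px) (⊥-elim ∘ ¬py) l)
                ... | inj₂ l = inj₂ (tie (⊥-elim ∘ ¬py) (⊥-elim ∘ ¬px) l)

              open Levels 𝒢 Core hn hn-core hn-sym hn-≤3 p u p-core (linked⇒hn (edge u-core (tree-∈ tr)))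
                (core-spread p-core) preference

              -- A low tree hangs away from the root edge.
              descending : ∀ m {k s q} → Tree k s q → k ≤ n → s ∈ ball m → q ∉ ball m → ⊥
              descending zero t k≤n (here refl) q∉ =
                <-irrefl (sym (proj₁ (two-parents tr t λ { refl → q∉ (there (here refl)) }))) (s≤s k≤n)
              descending zero (tip d _) k≤n (there (here refl)) q∉ = proj₂ u-core d
              descending zero t@(fork _ _ _ _) k≤n (there (here refl)) q∉ =
                <-irrefl (tree-height (tree-child t (nb-sym (tree-∈ tr)) λ { refl → q∉ (here refl) }) tr) (<-trans k≤n (n<1+n n))
              descending (suc m) {k} {s} {q} t k≤n s∈ q∉ with s ∈? ball m | ball-suc⁻ m s∈
              ... | yes s∈′ | _ = descending m t k≤n s∈′ (q∉ ∘ ∈-++⁺ˡ)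
              ... | no s∉ | inj₁ s∈′ = s∉ s∈′
              ... | no s∉ | inj₂ (r , r∈ , s∈r) with linked-edge (ball-core (suc m) s∈) (hn-sym (ball-core m r∈) s∈r)
              ... | inj₁ refl = s∉ r∈
              ... | inj₂ (cr , r∈s) with t
              ... | tip d _ = proj₂ (ball-core (suc m) s∈) d
              ... | fork _ _ _ f = descending m (f r r∈s λ { refl → q∉ (∈-++⁺ˡ r∈) }) (≤-trans (n≤1+n _) k≤n) r∈ s∉

              -- Any other core neighbour of `q` is the root of a tree of depth `n` below `q`; by
              -- `descending` the search cannot meet it before `q`.
              lower-parent : ∀ m {q t s} → Level m q → Tree (suc n) q t → s ∈ hn q → s ∈ ball m → s ≡ t
              lower-parent m {q} {t} {s} (_ , q∉) tq s∈q s∈ with s ≟ t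
              ... | yes e = e
              ... | no s≢t with linked-edge (tree-core tq) s∈q
              ... | inj₁ refl = ⊥-elim (q∉ s∈)
              ... | inj₂ (_ , s∈nb) = ⊥-elim (descending m (tree-child tq s∈nb s≢t) ≤-refl s∈ q∉)

              -- If `q` were the lesser twin of `y`, then `y` would be preferred too. By
              -- `lower-parent` their common lower neighbour is the parent of both, so `y` would be
              -- a sibling of `q`.
              single-white : ∀ {q t} → q ≢ p → Single q t → ¬ CoreBlack q
              single-white q≢p _ (inj₁ e) = q≢p e
              single-white q≢p s (inj₂ (_ , _ , _ , prefer ¬pq _)) = ¬pq (_ , tree-∈ (proj₁ s) , s)
              single-white {q} {t} q≢p s@(tq , only) (inj₂ (m , y , tw , tie f _ _)) with f (_ , tree-∈ tq , s)
              ... | t′ , t′∈ , ty , _ with below m (Twin.levelˡ tw)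
              ... | r , r∈ , rq with lower-parent m (Twin.levelˡ tw) tq rq r∈
                                   | lower-parent m (Twin.levelʳ tw) ty (Twin.lowerˡ tw rq r∈) r∈
              ... | refl | refl = only y (nb-sym t′∈) (≢-sym (Twin.distinct tw)) ty

              open Extend CoreBlack CoreBlack? NoRoot NoRoot? no-root-opposite

              module _ (φ : Automorphism 𝒢) (keep : Preserves colouring φ) where

                open Automorphism φ

                single-p : Single (to p) (to u)
                single-p = tree-to φ tr , λ r r∈ r≢ tr′ → alone {from r}
                  ( subst (λ w → from r ∈ nb w) (from-to u) (from-nb r∈)
                  , (λ e → r≢ (trans (sym (to-from r)) (cong to e)))
                  , subst (Tree (suc n) (from r)) (from-to u) (tree-to (inverse φ) tr′) )

                -- Being the root of an unpaired tree is invariant, and `p` is the only black vertex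
                -- with this property.
                fix-p : to p ≡ p
                fix-p = decidable-stable (to p ≟ p) λ p≢ →
                  single-white p≢ single-p (proj₁ (core-keep φ keep p p-core) (inj₁ refl))

                fix-u : to u ≡ u
                fix-u = decidable-stable (to u ≟ u) λ u≢ →
                  no-center (proj₂ (proj₂ (proj₂ (two-parents (subst (λ w → Tree (suc n) w (to u)) fix-p (tree-to φ tr)) tr u≢))))

                fixed : ∀ x → to x ≡ x
                fixed = all-fixed φ keep (core-fixed φ (hn-to φ) (hn-to⁻ φ) (core-keep φ keep) fix-p fix-u) λ ()

              two-distinguishable : TwoDistinguishable 𝒢
              two-distinguishable = colouring , fixed

          -- A centre exists: the isomorphism with R^1

          module Centered (N : ℕ) (r : Vertex) (center : Center N r) where

            module _ {n p u} (t : Tree (suc n) p u) where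

              abstract
                kids : ∃ λ (k : Bool → Vertex) → (∀ b → k b ∈ nb p × k b ≢ u)
                     × (∀ b → k (not b) ≢ k b) × (∀ {q} → q ∈ nb p → q ≢ u → ∃ λ b → k b ≡ q)
                kids with tree-third t u
                ... | a , a∈ , a≢u , _ with tree-third t a
                ... | b , b∈ , b≢u , b≢a = (λ i → if i then a else b)
                  , (λ { true → a∈ , a≢u ; false → b∈ , b≢u })
                  , (λ { true → b≢a ; false → ≢-sym b≢a })
                  , λ q∈ q≢u → case three-neighbours a∈ b∈ (tree-∈ t) (≢-sym b≢a) a≢u b≢u q∈ of λ
                      { (inj₁ e) → true , sym e ; (inj₂ (inj₁ e)) → false , sym e ; (inj₂ (inj₂ e)) → ⊥-elim (q≢u e) }

              kid : Bool → Vertex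
              kid = proj₁ kids

              kid-∈ : ∀ b → kid b ∈ nb p
              kid-∈ b = proj₁ (proj₁ (proj₂ kids) b)

              kid-tree : ∀ b → Tree n (kid b) p
              kid-tree b = tree-child t (kid-∈ b) (proj₂ (proj₁ (proj₂ kids) b))

              kid-sibling : ∀ b → Sibling n (kid b) p (kid (not b))
              kid-sibling b = kid-∈ (not b) , proj₁ (proj₂ (proj₂ kids)) b , kid-tree (not b)

              kid-injective : ∀ a b → kid a ≡ kid b → a ≡ b
              kid-injective true  true  _ = refl
              kid-injective true  false e = ⊥-elim (proj₁ (proj₂ (proj₂ kids)) false e)
              kid-injective false true  e = ⊥-elim (proj₁ (proj₂ (proj₂ kids)) true e)
              kid-injective false false _ = refl

              kid-cover : ∀ {q} → q ∈ nb p → q ≢ u → ∃ λ b → kid b ≡ q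
              kid-cover = proj₂ (proj₂ (proj₂ kids))

            embed : ∀ {n p u} → Tree n p u → BV n → Vertex
            embed {p = p} t top = p
            embed t (sub b x)   = embed (kid-tree t b) x

            -- Iterated parents. Each step carries a sibling because `parent-unique` needs one.
            data Climb : ℕ → Vertex → Vertex → Set where
              stop  : ∀ {x} → Climb 0 x x
              climb : ∀ {n i x t y z} → Tree n x t → Sibling n x t y → Climb i t z → Climb (suc i) x z

            climb-functional : ∀ {i x z z′} → Climb i x z → Climb i x z′ → z ≡ z′
            climb-functional stop stop = refl
            climb-functional (climb t s p) (climb t′ _ p′) with parent-unique t s t′
            ... | _ , refl = climb-functional p p′

            climb-snoc : ∀ {n i x z t y} → Climb i x z → Tree n z t → Sibling n z t y → Climb (suc i) x t
            climb-snoc stop t s = climb t s stop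
            climb-snoc (climb t′ s′ p) t s = climb t′ s′ (climb-snoc p t s)

            embed-climb : ∀ {n p u} (t : Tree n p u) x → Climb (depth x) (embed t x) p
            embed-climb t top = stop
            embed-climb t (sub b x) = climb-snoc (embed-climb (kid-tree t b) x) (kid-tree t b) (kid-sibling t b)

            -- Height `k` plus depth `i` is constant, so the height of a vertex, which is intrinsic,
            -- reveals its depth.
            Placed : ℕ → ℕ → Vertex → Set
            Placed n i z = ∃₂ λ k w → Tree k z w × ∃ (Sibling k z w) × k + i ≡ n

            embed-placed : ∀ {n p u s} (t : Tree n p u) → Sibling n p u s → ∀ x → Placed n (depth x) (embed t x)
            embed-placed {n} t s top = n , _ , t , (_ , s) , +-identityʳ n
            embed-placed t s (sub b x) = let k , w , tk , sk , e = embed-placed (kid-tree t b) (kid-sibling t b) x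
                                         in k , w , tk , sk , trans (+-suc k (depth x)) (cong suc e)

            -- A common vertex has one height, hence the same depth in both trees; climbing that
            -- many steps leads to both roots. So distinct branches are disjoint.
            embed-meet : ∀ {n p u s p′ u′ s′} (t : Tree n p u) → Sibling n p u s → (t′ : Tree n p′ u′) → Sibling n p′ u′ s′ →
              ∀ x y → embed t x ≡ embed t′ y → p ≡ p′
            embed-meet t s t′ s′ x y e with embed-placed t s x | embed-placed t′ s′ y
            ... | k , _ , tk , (_ , sk) , eq | k′ , _ , tk′ , _ , eq′
              with parent-unique tk sk (subst (λ z → Tree k′ z _) (sym e) tk′)
            ... | refl , _ with +-cancelˡ-≡ k (depth x) (depth y) (trans eq (sym eq′))
            ... | de = climb-functional (embed-climb t x)
              (subst (λ i → Climb i _ _) (sym de) (subst (λ z → Climb (depth y) z _) (sym e) (embed-climb t′ y)))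

            embed-deep : ∀ {n p u s} (t : Tree (suc n) p u) → Sibling (suc n) p u s → ∀ b x → p ≢ embed (kid-tree t b) x
            embed-deep {n} t s b x e with embed-placed (kid-tree t b) (kid-sibling t b) x
            ... | k , _ , tk , _ , eq with parent-unique t s (subst (λ z → Tree k z _) (sym e) tk)
            ... | refl , _ = <-irrefl (sym eq) (m≤m+n (suc n) (depth x))

            embed-injective : ∀ {n p u s} (t : Tree n p u) → Sibling n p u s → ∀ x y → embed t x ≡ embed t y → x ≡ y
            embed-injective t s top top _ = refl
            embed-injective t s top (sub b y) e = ⊥-elim (embed-deep t s b y e)
            embed-injective t s (sub b x) top e = ⊥-elim (embed-deep t s b x (sym e))
            embed-injective t s (sub a x) (sub b y) e
              with kid-injective t a b (embed-meet (kid-tree t a) (kid-sibling t a) (kid-tree t b) (kid-sibling t b) x y e)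
            ... | refl = cong (sub a) (embed-injective (kid-tree t a) (kid-sibling t a) x y e)

            embed-par : ∀ {n p u} (t : Tree n p u) {x y} → BPar x y → embed t y ∈ nb (embed t x)
            embed-par t (top-sub b) = kid-∈ t b
            embed-par t (sub-sub b e) = embed-par (kid-tree t b) e

            embed-leaf : ∀ {n p u} (t : Tree n p u) {x} → BLeaf x → D (embed t x)
            embed-leaf (tip d _) leaf0 = d
            embed-leaf t (leafS b l) = embed-leaf (kid-tree t b) l

            embed-kind : ∀ {n p u} (t : Tree n p u) x → BLeaf x ⊎ Core (embed t x)
            embed-kind (tip _ _) top = inj₁ leaf0
            embed-kind (fork c _ _ _) top = inj₂ c
            embed-kind t (sub b x) with embed-kind (kid-tree t b) x
            ... | inj₁ l = inj₁ (leafS b l)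
            ... | inj₂ c = inj₂ c

            data Lift {n p u} (t : Tree n p u) (x : BV n) (z : Vertex) : Set where
              out  : x ≡ top → z ≡ u → Lift t x z
              down : ∀ y → embed t y ≡ z → BPar x y → Lift t x z
              up   : ∀ y → embed t y ≡ z → BPar y x → Lift t x z
              side : BLeaf x → S z → Lift t x z

            embed-lift : ∀ {n p u} (t : Tree n p u) x {z} → z ∈ nb (embed t x) → Lift t x z
            embed-lift (tip d p) top {z} z∈ with S? z
            ... | yes s = side leaf0 s
            ... | no ¬s = out refl (plain-unique d (z∈ , ¬s) p)
            embed-lift {u = u} t@(fork _ _ _ _) top {z} z∈ with z ≟ u
            ... | yes e = out refl e
            ... | no z≢u = let b , e = kid-cover t z∈ z≢u in down (sub b top) e (top-sub b)
            embed-lift t (sub b x) z∈ with embed-lift (kid-tree t b) x z∈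
            ... | out refl refl = up top refl (top-sub b)
            ... | down y e p = down (sub b y) e (sub-sub b p)
            ... | up y e p = up (sub b y) e (sub-sub b p)
            ... | side l s = side (leafS b l) s

            abstract
              spokes : ∃ λ (f : Fin 3 → Vertex) → (∀ i → f i ∈ nb r)
                     × (∀ i j → f i ≡ f j → i ≡ j) × (∀ {q} → q ∈ nb r → ∃ λ i → f i ≡ q)
              spokes with third-neighbour (proj₁ (proj₂ center)) r r
              ... | a , a∈ , _ with third-neighbour (proj₁ (proj₂ center)) a a
              ... | b , b∈ , b≢a , _ with third-neighbour (proj₁ (proj₂ center)) a b
              ... | c , c∈ , c≢a , c≢b = triple a b c
                , (λ { zero → a∈ ; (suc zero) → b∈ ; (suc (suc zero)) → c∈ })
                , triple-injective (≢-sym b≢a) (≢-sym c≢a) (≢-sym c≢b)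
                , λ q∈ → case three-neighbours a∈ b∈ c∈ (≢-sym b≢a) (≢-sym c≢a) (≢-sym c≢b) q∈ of λ
                    { (inj₁ e) → zero , sym e ; (inj₂ (inj₁ e)) → suc zero , sym e ; (inj₂ (inj₂ e)) → suc (suc zero) , sym e }

            spoke : Fin 3 → Vertex
            spoke = proj₁ spokes

            spoke-∈ : ∀ i → spoke i ∈ nb r
            spoke-∈ = proj₁ (proj₂ spokes)

            spoke-injective : ∀ i j → spoke i ≡ spoke j → i ≡ j
            spoke-injective = proj₁ (proj₂ (proj₂ spokes))

            spoke-tree : ∀ i → Tree N (spoke i) r
            spoke-tree i = proj₂ (proj₂ center) (spoke-∈ i)

            spoke-sibling : ∀ i → ∃ (Sibling N (spoke i) r)
            spoke-sibling i = let j , j≢i = another i in spoke j , spoke-∈ j , (λ e → j≢i (spoke-injective j i e)) , spoke-tree j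
              where
              another : ∀ (i : Fin 3) → ∃ λ j → j ≢ i
              another zero    = suc zero , λ ()
              another (suc _) = zero , λ ()

            placeT : TV N → Vertex
            placeT root     = r
            placeT (br i x) = embed (spoke-tree i) x

            placeT-leaf : ∀ {x} → TLeaf x → D (placeT x)
            placeT-leaf (leaf i l) = embed-leaf (spoke-tree i) l

            placeT-kind : ∀ x → TLeaf x ⊎ Core (placeT x)
            placeT-kind root = inj₂ (proj₁ center)
            placeT-kind (br i x) with embed-kind (spoke-tree i) x
            ... | inj₁ l = inj₁ (leaf i l)
            ... | inj₂ c = inj₂ c

            placeT-≢S : ∀ x → ¬ S (placeT x)
            placeT-≢S x with placeT-kind x
            ... | inj₁ l = D⇒¬S (placeT-leaf l)
            ... | inj₂ c = proj₁ c

            D⇒leaf : ∀ x → D (placeT x) → TLeaf x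
            D⇒leaf x d with placeT-kind x
            ... | inj₁ l = l
            ... | inj₂ c = ⊥-elim (proj₂ c d)

            placeT-par : ∀ {x y} → TPar x y → placeT y ∈ nb (placeT x)
            placeT-par (root-br i) = spoke-∈ i
            placeT-par (br-br i e) = embed-par (spoke-tree i) e

            placeT-edge : ∀ {x y : TV N} → TE x y → placeT y ∈ nb (placeT x)
            placeT-edge (inj₁ e) = placeT-par e
            placeT-edge (inj₂ e) = nb-sym (placeT-par e)

            placeT-lift : ∀ x {z} → z ∈ nb (placeT x) → (∃ λ y → placeT y ≡ z × TE x y) ⊎ (TLeaf x × S z)
            placeT-lift root z∈ = let i , e = proj₂ (proj₂ (proj₂ spokes)) z∈ in inj₁ (br i top , e , inj₁ (root-br i))
            placeT-lift (br i x) z∈ with embed-lift (spoke-tree i) x z∈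
            ... | out refl refl = inj₁ (root , refl , inj₂ (root-br i))
            ... | down y e p = inj₁ (br i y , e , inj₁ (br-br i p))
            ... | up y e p = inj₁ (br i y , e , inj₂ (br-br i p))
            ... | side l s = inj₂ (leaf i l , s)

            -- All neighbours of `r` have height `N`, so inside a branch `r` would have height
            -- `N + 1`, more than the branch contains.
            root-≢ : ∀ i x → r ≢ embed (spoke-tree i) x
            root-≢ i x e with embed-placed (spoke-tree i) (proj₂ (spoke-sibling i)) x
            ... | k , w , tk , _ , eq with subst (λ z → Tree k z w) (sym e) tk
            ... | tip d _ = proj₂ (proj₁ center) d
            ... | t@(fork {j} _ _ _ _) with tree-third t w
            ... | q , q∈ , q≢w , _ with tree-height (tree-child t q∈ q≢w) (proj₂ (proj₂ center) q∈)
            ... | refl = <-irrefl (sym eq) (m≤m+n (suc N) (depth x))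

            placeT-injective : ∀ x y → placeT x ≡ placeT y → x ≡ y
            placeT-injective root root _ = refl
            placeT-injective root (br i y) e = ⊥-elim (root-≢ i y e)
            placeT-injective (br i x) root e = ⊥-elim (root-≢ i x (sym e))
            placeT-injective (br i x) (br j y) e
              with spoke-injective i j (embed-meet (spoke-tree i) (proj₂ (spoke-sibling i)) (spoke-tree j) (proj₂ (spoke-sibling j)) x y e)
            ... | refl = cong (br i) (embed-injective (spoke-tree i) (proj₂ (spoke-sibling i)) x y e)

            Opposite? : ∀ c d → Dec (Opposite c d)
            Opposite? c d = map′ (λ (ne , s , s∈ , ss , d∈) → opposite ne s ss (nb-sym s∈) d∈)
              (λ (opposite ne s ss c∈ d∈) → ne , s , nb-sym c∈ , ss , d∈)
              (¬? (c ≟ d) ×-dec ∃∈? (λ s → S? s ×-dec (d ∈? nb s)) (nb c))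

            corners-opposite : ∀ {x y} → TLeaf x → TLeaf y → x ≢ y → (Σ (TV N) λ w → TE w x × TE w y) →
              Opposite (placeT x) (placeT y)
            corners-opposite {x} {y} lx ly x≢y (w , wx , wy) with opposite-∃ (placeT-leaf lx)
            ... | d , o with placeT y ≟ d
            ... | yes refl = o
            ... | no ≢d = ⊥-elim (no-third-D o (plain wx) (plain wy) (placeT-leaf ly) (λ e → x≢y (sym (placeT-injective y x e))) ≢d)
              where
              plain : ∀ {v} → TE w v → Plain (placeT v) (placeT w)
              plain e = nb-sym (placeT-edge e) , placeT-≢S w

            opposite-end : ∀ {c d s} → Opposite c d → s ∈ nb c → S s → d ∈ nb s
            opposite-end {c} {d} {s} o s∈ ss = let e , e∈ , e≢c = other-end ss c in
              subst (_∈ nb s) (opposite-unique (opposite (≢-sym e≢c) s ss (nb-sym s∈) e∈) o) e∈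

            -- `SBlack` serves here as a label: it tells the two valence-2 vertices of a diamond
            -- apart.
            Sided : Bool → Vertex → Vertex → Set
            Sided b c s = s ∈ nb c × S s × (if b then SBlack s else ¬ SBlack s)

            abstract
              side-of : ∀ {c} → D c → ∀ b → ∃ (Sided b c)
              side-of {c} (s , s∈ , ss) = pick (≺-total (Mate.distinct sm))
                where
                m : Vertex
                m = proj₁ (all-mated ss)
                sm : Mate s m
                sm = proj₂ (all-mated ss)
                m∈ : m ∈ nb c
                m∈ = nb-sym (Mate.ends sm (nb-sym s∈))
                pick : s ≺ m ⊎ m ≺ s → ∀ b → ∃ (Sided b c)
                pick (inj₁ l) true  = s , s∈ , ss , m , sm , l
                pick (inj₁ l) false = m , m∈ , Mate.Sʳ sm , λ b → ≺-asym l (mate-black mates-unique (mate-sym sm) b)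
                pick (inj₂ l) true  = m , m∈ , Mate.Sʳ sm , s , mate-sym sm , l
                pick (inj₂ l) false = s , s∈ , ss , λ b → ≺-asym l (mate-black mates-unique sm b)

            sided-∃ : ∀ {c s} → s ∈ nb c → S s → ∃ λ b → Sided b c s
            sided-∃ {s = s} s∈ ss with SBlack? s
            ... | yes b = true , s∈ , ss , b
            ... | no ¬b = false , s∈ , ss , ¬b

            sided-unique : ∀ {c s t} b → Sided b c s → Sided b c t → s ≡ t
            sided-unique {c} {s} {t} b (s∈ , ss , bs) (t∈ , st , bt) = decidable-stable (s ≟ t) λ s≢t →
              clash b bs bt (S-near s∈ t∈ ss st s≢t)
              where
              clash : ∀ b → (if b then SBlack s else ¬ SBlack s) → (if b then SBlack t else ¬ SBlack t) → ¬ Mate s t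
              clash true  bs bt m = ≺-asym (mate-black mates-unique m bs) (mate-black mates-unique (mate-sym m) bt)
              clash false bs bt m with ≺-total (Mate.distinct m)
              ... | inj₁ l = bs (_ , m , l)
              ... | inj₂ l = bt (_ , mate-sym m , l)

            sided-clash : ∀ {c d s} a b → Sided a c s → Sided b d s → a ≡ b
            sided-clash true  true  _ _ = refl
            sided-clash true  false (_ , _ , b) (_ , _ , ¬b) = ⊥-elim (¬b b)
            sided-clash false true  (_ , _ , ¬b) (_ , _ , b) = ⊥-elim (¬b b)
            sided-clash false false _ _ = refl

            ascending : Vertex → Vertex → Bool
            ascending x y = does (x ≺? y)

            ascending-flip : ∀ {x y} → x ≢ y → ascending y x ≡ not (ascending x y)
            ascending-flip {x} {y} x≢y with x ≺? y | y ≺? x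
            ... | yes l | yes l′ = ⊥-elim (≺-asym l l′)
            ... | yes _ | no _ = refl
            ... | no _ | yes _ = refl
            ... | no ¬l | no ¬l′ with ≺-total x≢y
            ... | inj₁ l = ⊥-elim (¬l l)
            ... | inj₂ l = ⊥-elim (¬l′ l)

            new-opposite : ∀ (v : NewV N) → Opposite (placeT (NewV.u v)) (placeT (NewV.v v))
            new-opposite (newv x y lx ly x≢y common) =
              -- The side conditions of `newv` are irrelevant; decidability of `Opposite` recovers a
              -- usable proof.
              recompute (Opposite? (placeT x) (placeT y)) (corners-opposite lx ly x≢y common)

            module _ (v : NewV N) where
              open NewV v using () renaming (u to x; v to y)

              -- The two orders of a pair of leaves have opposite bits and so take the two different
              -- valence-2 vertices of the diamond.
              new-bit : Bool
              new-bit = ascending (placeT x) (placeT y)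

              placeN : Vertex
              placeN = proj₁ (side-of (opposite-D (new-opposite v)) new-bit)

              placeN-sidedˡ : Sided new-bit (placeT x) placeN
              placeN-sidedˡ = proj₂ (side-of (opposite-D (new-opposite v)) new-bit)

              placeN-sidedʳ : Sided new-bit (placeT y) placeN
              placeN-sidedʳ = let s∈ , ss , b = placeN-sidedˡ in nb-sym (opposite-end (new-opposite v) s∈ ss) , ss , b

              placeN-S : S placeN
              placeN-S = proj₁ (proj₂ placeN-sidedˡ)

              placeN-ends : ∀ {z} → z ∈ nb placeN → z ≡ placeT x ⊎ z ≡ placeT y
              placeN-ends = two-neighbours placeN-S (nb-sym (proj₁ placeN-sidedˡ)) (nb-sym (proj₁ placeN-sidedʳ))
                (Opposite.distinct (new-opposite v))

            newv-≡ : ∀ {v w : NewV N} → NewV.u v ≡ NewV.u w × NewV.v v ≡ NewV.v w → v ≡ w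
            newv-≡ {newv _ _ _ _ _ _} {newv _ _ _ _ _ _} (refl , refl) = refl

            -- The ends of the vertex determine the unordered pair of leaves, its label the order.
            placeN-injective : ∀ v w → placeN v ≡ placeN w → v ≡ w
            placeN-injective v w e = newv-≡ (match
              (placeN-ends w (subst (λ s → placeT (NewV.u v) ∈ nb s) e (nb-sym (proj₁ (placeN-sidedˡ v)))))
              (placeN-ends w (subst (λ s → placeT (NewV.v v) ∈ nb s) e (nb-sym (proj₁ (placeN-sidedʳ v))))))
              where
              open NewV v using () renaming (u to x; v to y)
              open NewV w using () renaming (u to x′; v to y′)
              x≢y : placeT x ≢ placeT y
              x≢y = Opposite.distinct (new-opposite v)
              same-bit : new-bit v ≡ new-bit w
              same-bit = sided-clash (new-bit v) (new-bit w) (placeN-sidedˡ v) (subst (Sided _ _) (sym e) (placeN-sidedˡ w))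
              match : placeT x ≡ placeT x′ ⊎ placeT x ≡ placeT y′ → placeT y ≡ placeT x′ ⊎ placeT y ≡ placeT y′ →
                      x ≡ x′ × y ≡ y′
              match (inj₁ ex) (inj₁ ey) = ⊥-elim (x≢y (trans ex (sym ey)))
              match (inj₂ ex) (inj₂ ey) = ⊥-elim (x≢y (trans ex (sym ey)))
              match (inj₁ ex) (inj₂ ey) = placeT-injective _ _ ex , placeT-injective _ _ ey
              match (inj₂ ex) (inj₁ ey) = ⊥-elim (not-≢ (new-bit v)
                (trans (sym (ascending-flip x≢y)) (trans (cong₂ ascending ey ex) (sym same-bit))))

            placeR : RV N → Vertex
            placeR (old x) = placeT x
            placeR (new v) = placeN v

            placeR-injective : ∀ x y → placeR x ≡ placeR y → x ≡ y
            placeR-injective (old x) (old y) e = cong old (placeT-injective x y e)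
            placeR-injective (old x) (new w) e = ⊥-elim (placeT-≢S x (subst S (sym e) (placeN-S w)))
            placeR-injective (new v) (old y) e = ⊥-elim (placeT-≢S y (subst S e (placeN-S v)))
            placeR-injective (new v) (new w) e = cong new (placeN-injective v w e)

            placeR-edge : ∀ {x y} → RE x y → placeR y ∈ nb (placeR x)
            placeR-edge (oo e)  = placeT-edge e
            placeR-edge (on₁ v) = proj₁ (placeN-sidedˡ v)
            placeR-edge (on₂ v) = proj₁ (placeN-sidedʳ v)
            placeR-edge (no₁ v) = nb-sym (proj₁ (placeN-sidedˡ v))
            placeR-edge (no₂ v) = nb-sym (proj₁ (placeN-sidedʳ v))

            TE-sym : ∀ {x y : TV N} → TE x y → TE y x
            TE-sym (inj₁ e) = inj₂ e
            TE-sym (inj₂ e) = inj₁ e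

            -- The opposite corner is found one step up and one step down: by `looped` both corners
            -- have the same plain neighbour, and `placeT-lift` keeps the steps inside the tree.
            other-corner : ∀ x → TLeaf x → ∃ λ y → TLeaf y × Opposite (placeT x) (placeT y) × Σ (TV N) λ w → TE w x × TE w y
            other-corner x lx with plain-∃ (placeT-leaf lx) | opposite-∃ (placeT-leaf lx)
            ... | q , p | d , o with placeT-lift x (proj₁ p)
            ... | inj₂ (_ , s) = ⊥-elim (proj₂ p s)
            ... | inj₁ (w , refl , e) with placeT-lift w (nb-sym (proj₁ (looped o p)))
            ... | inj₂ (_ , s) = ⊥-elim (D⇒¬S (opposite-D (opposite-sym o)) s)
            ... | inj₁ (y , refl , e′) = y , D⇒leaf y (opposite-D (opposite-sym o)) , o , w , TE-sym e , e′

            side-lift : ∀ x → TLeaf x → ∀ {z} → z ∈ nb (placeT x) → S z → ∃ λ y → placeR y ≡ z × RE (old x) y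
            side-lift x lx {z} z∈ sz with other-corner x lx | sided-∃ z∈ sz
            ... | y , ly , o , w , wx , wy | b , sb = choose (new-bit xy ≟ᵇ b)
              where
              xy yx : NewV N
              xy = newv x y lx ly (λ e → Opposite.distinct o (cong placeT e)) (w , wx , wy)
              yx = newv y x ly lx (λ e → Opposite.distinct o (cong placeT (sym e))) (w , wy , wx)
              choose : Dec (new-bit xy ≡ b) → ∃ λ y → placeR y ≡ z × RE (old x) y
              choose (yes e) = new xy , sided-unique b (subst (λ c → Sided c (placeT x) (placeN xy)) e (placeN-sidedˡ xy)) sb , on₁ xy
              choose (no b≢) = new yx , sided-unique b (subst (λ c → Sided c (placeT x) (placeN yx)) bit (placeN-sidedʳ yx)) sb , on₂ yx
                where
                bit : new-bit yx ≡ b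
                bit = trans (ascending-flip (Opposite.distinct o)) (sym (≢⇒≡not (≢-sym b≢)))

            placeR-lift : ∀ x {z} → z ∈ nb (placeR x) → ∃ λ y → placeR y ≡ z × RE x y
            placeR-lift (old x) z∈ with placeT-lift x z∈
            ... | inj₁ (y , e , xy) = old y , e , oo xy
            ... | inj₂ (l , s) = side-lift x l z∈ s
            placeR-lift (new v) z∈ with placeN-ends v z∈
            ... | inj₁ e = old (NewV.u v) , sym e , no₁ v
            ... | inj₂ e = old (NewV.v v) , sym e , no₂ v

            model : Unfolding R¹[1+ N ] 𝒢
            model = record
              { base = old root ; place = placeR ; injective = placeR-injective ; edges = placeR-edge ; lift = placeR-lift }

-- Translation between the given graph and neighbour lists

module Presentation (G : Graph) (simple : IsSimple G) (conn : Connected G) (valences : MaxValence3 G) where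

  k : V G → ℕ
  k v = proj₁ (proj₁ valences v)

  ns : ∀ v → Fin (k v) → V G
  ns v = proj₁ (proj₂ (proj₂ (proj₁ valences v)))

  ns-injective : ∀ v i j → ns v i ≡ ns v j → i ≡ j
  ns-injective v = proj₁ (proj₂ (proj₂ (proj₂ (proj₁ valences v))))

  number : ∀ {v w} → E G v w → ∃ λ i → ns v i ≡ w
  number {v} {w} = Equivalence.to (proj₂ (proj₂ (proj₂ (proj₂ (proj₁ valences v)))) w)

  numbered : ∀ v i → E G v (ns v i)
  numbered v i = Equivalence.from (proj₂ (proj₂ (proj₂ (proj₂ (proj₁ valences v)))) _) (i , refl)

  neighbours : V G → List (V G)
  neighbours v = tabulate (ns v)

  E⇒∈ : ∀ {v w} → E G v w → w ∈ neighbours v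
  E⇒∈ {v} e = let i , eq = number e in subst (_∈ neighbours v) eq (∈-tabulate⁺ i)

  ∈⇒E : ∀ {v w} → w ∈ neighbours v → E G v w
  ∈⇒E {v} w∈ = let i , eq = ∈-tabulate⁻ w∈ in subst (E G v) (sym eq) (numbered v i)

  neighbours-unique : ∀ v → Unique (neighbours v)
  neighbours-unique v = Unique.tabulate⁺ (ns-injective v _ _)

  code : ∀ {a b} → Walk G a b → List ℕ
  code here       = []
  code (step e w) = toℕ (proj₁ (number e)) ∷ code w

  code-end : ∀ {a b c} (w : Walk G a b) (w′ : Walk G a c) → code w ≡ code w′ → b ≡ c
  code-end here here _ = refl
  code-end {a} (step e w) (step e′ w′) eq with ∷-injective eq
  ... | h , t with trans (sym (proj₂ (number e))) (trans (cong (ns a) (toℕ-injective h)) (proj₂ (number e′)))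
  ... | refl = code-end w w′ t

  origin : V G
  origin = proj₁ (proj₂ valences)

  -- Connectedness supplies a walk to every vertex; reading it off
  -- makes equality decidable and orders the vertices.
  address : V G → List ℕ
  address v = code (conn origin v)

  address-injective : ∀ {v w} → address v ≡ address w → v ≡ w
  address-injective {v} {w} = code-end (conn origin v) (conn origin w)

  ordering : Tiebreak (V G)
  ordering = record
    { _≺_ = λ v w → address v <ₗ address w
    ; _≺?_ = λ v w → Lex.<-decidable ℕₚ._≟_ ℕₚ._<?_ (address v) (address w)
    ; ≺-asym = asym _ _
    ; ≺-total = total
    }
    where
    _<ₗ_ : List ℕ → List ℕ → Set
    _<ₗ_ = Lex.Lex-< _≡_ _<_
    compare = Lex.<-compare sym <-cmp
    asym : ∀ xs ys → xs <ₗ ys → ¬ ys <ₗ xs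
    asym xs ys l l′ with compare xs ys
    ... | tri< _ _ ¬l′ = ¬l′ l′
    ... | tri≈ ¬l _ _ = ¬l l
    ... | tri> ¬l _ _ = ¬l l
    total : ∀ {v w} → v ≢ w → address v <ₗ address w ⊎ address w <ₗ address v
    total {v} {w} v≢w with compare (address v) (address w)
    ... | tri< l _ _ = inj₁ l
    ... | tri≈ _ e _ = ⊥-elim (v≢w (address-injective (Pointwise-≡⇒≡ e)))
    ... | tri> _ _ l = inj₂ l

  spread-walk : ∀ (P : V G → Set) → (∀ {x y} → y ∈ neighbours x → P x → P y) → ∀ {x y} → Walk G x y → P x → P y
  spread-walk P P-step here       Px = Px
  spread-walk P P-step (step e w) Px = spread-walk P P-step w (P-step (E⇒∈ e) Px)

  cubic : CubicGraph
  cubic = record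
    { Vertex = V G
    ; _≟_ = λ v w → map′ address-injective (cong address) (≡-dec ℕₚ._≟_ (address v) (address w))
    ; nb = neighbours
    ; nb-unique = neighbours-unique
    ; nb-sym = λ y∈ → E⇒∈ (proj₁ simple _ _ (∈⇒E y∈))
    ; nb-irrefl = λ x∈ → proj₂ simple _ (∈⇒E x∈)
    ; nb-≤3 = λ v → subst (_≤ 3) (sym (length-tabulate (ns v))) (proj₁ (proj₂ (proj₁ valences v)))
    ; tiebreak = ordering
    ; spread = λ P P-step {x} Px y → spread-walk P P-step (conn x y) Px
    }

  open CubicGraph cubic

  valence : ∀ {v n} → HasValence G v n → length (nb v) ≡ n
  valence {v} {n} (f , f-injective , adj) = trans
    (≤-antisym
      (unique-⊆-length (nb-unique v) λ x∈ → let i , e = Equivalence.to (adj _) (∈⇒E x∈) in subst (_∈ tabulate f) e (∈-tabulate⁺ i))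
      (unique-⊆-length (Unique.tabulate⁺ (f-injective _ _)) λ x∈ → let i , e = ∈-tabulate⁻ x∈ in E⇒∈ (Equivalence.from (adj _) (i , sym e))))
    (length-tabulate f)

  hasValence : ∀ {v n} → length (nb v) ≡ n → HasValence G v n
  hasValence {v} e = subst (HasValence G v) (trans (sym (length-tabulate (ns v))) e) (proj₂ (proj₂ (proj₁ valences v)))

  automorphism : Aut G → Automorphism cubic
  automorphism (f , adj) = record
    { to = Inverse.to f
    ; from = Inverse.from f
    ; to-from = Inverse.strictlyInverseˡ f
    ; from-to = Inverse.strictlyInverseʳ f
    ; to-nb = λ y∈ → E⇒∈ (Equivalence.to (adj _ _) (∈⇒E y∈))
    ; from-nb = λ {x} {y} y∈ → E⇒∈ (Equivalence.from (adj _ _)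
        (subst (λ w → E G w (Inverse.to f (Inverse.from f y))) (sym (Inverse.strictlyInverseˡ f x))
          (subst (E G x) (sym (Inverse.strictlyInverseˡ f y)) (∈⇒E y∈))))
    }

  flippable : (∀ v → HasValence G v 2 → ¬ Type1 G v) → Flippable cubic
  flippable not-type1 {x} {a} {b} len a∈ b∈ a≢b Q? use = decidable-stable Q? λ ¬q →
    not-type1 x (hasValence len) λ φ fix w xw → decidable-stable (aut φ w ≟ w) λ moved →
      let open Automorphism (automorphism φ)
          stays : ∀ {z} → z ∈ nb x → to z ≡ a ⊎ to z ≡ b
          stays {z} z∈ = two-neighbours len a∈ b∈ a≢b (subst (λ v → to z ∈ nb v) fix (to-nb z∈))
      in swap (automorphism φ) moved (λ a→b b→a → ¬q (use (automorphism φ) fix a→b b→a))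
           (two-neighbours len a∈ b∈ a≢b (E⇒∈ xw)) (stays a∈) (stays b∈)
    where
    swap : ∀ (φ : Automorphism cubic) {w} → let open Automorphism φ in to w ≢ w → (to a ≡ b → to b ≡ a → ⊥) →
      w ≡ a ⊎ w ≡ b → to a ≡ a ⊎ to a ≡ b → to b ≡ a ⊎ to b ≡ b → ⊥
    swap φ moved no-swap _           (inj₂ e) (inj₁ e′) = no-swap e e′
    swap φ moved no-swap (inj₁ refl) (inj₁ e) _         = moved e
    swap φ moved no-swap (inj₂ refl) _        (inj₂ e)  = moved e
    swap φ moved no-swap _           (inj₂ e) (inj₂ e′) = a≢b (Automorphism.to-injective φ (trans e (sym e′)))
    swap φ moved no-swap _           (inj₁ e) (inj₁ e′) = a≢b (Automorphism.to-injective φ (trans e (sym e′)))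

  distinguishable : TwoDistinguishable cubic → D≤2 G
  distinguishable (c , rigid) = colour , λ φ same → rigid (automorphism φ) λ x →
      colour-black x (aut φ x) (sym (same x)) , colour-black (aut φ x) x (same x)
    where
    open TwoColouring c
    colour : V G → Fin 2
    colour x = if does (Black? x) then suc zero else zero
    colour-black : ∀ x y → colour x ≡ colour y → Black x → Black y
    colour-black x y e b with Black? x | Black? y
    ... | _ | yes b′ = b′
    ... | no ¬b | no _ = ⊥-elim (¬b b)
    colour-black x y () b | yes _ | no _

  isomorphic : ∀ {K} → Unfolding K cubic → Iso G K
  isomorphic {K} m =
      mk↔ₛ′ to place (λ y → injective _ _ (place-to (place y))) place-to
    , λ a b → mk⇔ (forth a b) (back a b)
    where
    open Unfolding m
    to : V G → V K
    to z = proj₁ (onto z)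
    place-to : ∀ z → place (to z) ≡ z
    place-to z = proj₂ (onto z)
    forth : ∀ a b → E G a b → E K (to a) (to b)
    forth a b e with lift (to a) (subst (λ z → b ∈ nb z) (sym (place-to a)) (E⇒∈ e))
    ... | y , eq , e′ = subst (E K (to a)) (injective _ _ (trans eq (sym (place-to b)))) e′
    back : ∀ a b → E K (to a) (to b) → E G a b
    back a b e = subst (λ z → E G z b) (place-to a) (subst (E G (place (to a))) (place-to b) (∈⇒E (edges e)))

-- Assembly of the cases by excluded middle under double negation

by-cases : ∀ {A B : Set} → (A → ¬ ¬ B) → (¬ A → ¬ ¬ B) → ¬ ¬ B
by-cases f g ¬b = g (λ a → f a ¬b) ¬b

theorem5p4 : (G : Graph) → IsSimple G → Connected G → MaxValence3 G →
    (Σ (V G) λ v → HasValence G v 2 × Type2 G v) →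
    (∀ v → HasValence G v 2 → ¬ Type1 G v) →
    ¬ ¬ (Iso G K23 ⊎ (Σ ℕ λ m → Iso G R¹[1+ m ]) ⊎ D≤2 G)
theorem5p4 G simple conn valences (v , v2 , _) not-type1 =
  by-cases
    (λ ((x , y , z , xy , xz , y≢z) : ∃₂ λ x y → ∃ λ z → Mate x y × Mate x z × y ≢ z) →
      return (inj₁ (isomorphic (Theta.model xy xz y≢z))))
    λ no-triple → subdivided λ {x} {y} {z} xy xz → decidable-stable (y ≟ z) λ y≢z → no-triple (x , y , z , xy , xz , y≢z)
  where
  open Presentation G simple conn valences
  open CubicGraph cubic
  Goal : Set
  Goal = Iso G K23 ⊎ (Σ ℕ λ m → Iso G R¹[1+ m ]) ⊎ D≤2 G
  return : Goal → ¬ ¬ Goal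
  return g ¬g = ¬g g
  coloured : TwoDistinguishable cubic → ¬ ¬ Goal
  coloured c = return (inj₂ (inj₂ (distinguishable c)))
  hub : ∃ λ t → length (nb t) ≡ 3
  hub = let t , t3 = proj₂ valences in t , valence t3
  flip : Flippable cubic
  flip = flippable not-type1
  open Subdividing cubic hub flip

  module _ (mates-unique : MatesUnique) (all-mated : ∀ {x} → S x → ∃ (Mate x)) where
    open Diamonds mates-unique all-mated

    module _ (separated : ∀ {c q} → D c → Plain c q → ¬ D q) where
      open Separated separated

      module _ (looped : ∀ {c d q} → Opposite c d → Plain c q → Plain d q) where
        open Looped looped

        module _ (no-center : ∀ {n r} → ¬ Center n r) where

          corner : ∃ λ c → D c
          corner = let c , c∈ , _ = other-end (valence v2) v in c , v , nb-sym c∈ , valence v2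

          uncentered : ¬ ¬ Goal
          uncentered = by-cases
            (λ ((n , p , u , tr , alone) : ∃₂ λ n p → ∃ λ u → Tree (suc n) p u × (∀ {y} → ¬ Sibling (suc n) p u y)) →
              coloured (NoCenter.Unpaired.two-distinguishable no-center n p u tr alone))
            λ paired → coloured (NoCenter.Canopy.two-distinguishable no-center (sibling paired) _ (proj₂ corner))
            where
            sibling : ¬ (∃₂ λ n p → ∃ λ u → Tree (suc n) p u × (∀ {y} → ¬ Sibling (suc n) p u y)) →
                      ∀ {n x t} → Tree n x t → ∃ (Sibling n x t)
            sibling paired {zero} tr = tip-sibling tr
            sibling paired {suc n} {x} {t} tr =
              decidable-stable (∃∈? (λ y → ¬? (y ≟ x) ×-dec Tree? (suc n) y t) (nb t)) λ none →
                paired (n , x , t , tr , λ {y} s → none (y , s))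

        looped-case : ¬ ¬ Goal
        looped-case = by-cases
          (λ ((n , r , c) : ∃₂ Center) → return (inj₂ (inj₁ (n ,
            isomorphic (Centered.model n r c)))))
          λ no-center → uncentered λ {n} {r} c → no-center (n , r , c)

      separated-case : ¬ ¬ Goal
      separated-case = by-cases
        (λ ((a , b , a′ , b′ , o , pa , pb , ne) : ∃₂ λ a b → ∃₂ λ a′ b′ → Opposite a b × Plain a a′ × Plain b b′ × a′ ≢ b′) →
          coloured (Bridge.two-distinguishable o pa pb ne))
        λ no-bridge → looped-case λ {c} {d} {q} o pc →
          let r , pd = plain-∃ (opposite-D (opposite-sym o)) in
          subst (Plain d) (sym (decidable-stable (q ≟ r) λ q≢r → no-bridge (c , d , q , r , o , pc , pd , q≢r))) pd

    mated : ¬ ¬ Goal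
    mated = by-cases
      (λ ((c , q , dc , dq , cq) : ∃₂ λ c q → D c × D q × Plain c q) → coloured (Necklace.two-distinguishable c q dc dq cq))
      λ apart → separated-case λ {c} {q} dc cq dq → apart (c , q , dc , dq , cq)

  subdivided : MatesUnique → ¬ ¬ Goal
  subdivided mates-unique = by-cases
    (λ ((w , sw , lonely) : ∃ λ w → S w × (∀ y → ¬ Mate w y)) → coloured (Lonely.two-distinguishable mates-unique w sw lonely))
    λ none → mated mates-unique λ {x} sx →
      let y , m , _ = decidable-stable (∃Mate? (λ _ → yes tt) x) λ no-mate → none (x , sx , λ y m → no-mate (y , m , tt))
      in y , m
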